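{- $\beta_B(C_4,k)=4^{ -4k}$ for every positive integer $k$.
   Context: $C_4$ is the cycle on 4 vertices. For a finite set $X$, $\mathcal{C}(X,H)$ is the set of subgraphs of the complete graph on $X$ isomorphic to $H$. For a probability mass $\mu$ on $\binom{X}{2}$ and a subgraph $G$ of the complete graph on $X$, $\mu(G)=\prod_{e\in E(G)}\mu(e)$. For a graph $H$ without isolated vertices and a positive integer $k$, $\beta_B(\mu;H,k)=\sum_{H'\in\mathcal{C}(X,H)}\mu(H')^k$ and $\beta_B(H,k)=\sup\beta_B(\mu;H,k)$ over all finite sets $X$ and probability masses $\mu$ on $\binom{X}{2}$.
   Formalization: The probability masses on the pairs of X (and the ε expressing the supremum) take rational instead of real values. -}

module Defs where

open import Data.Nat as ℕ using (ℕ; zero; suc)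
open import Data.Fin using (Fin; _<_)
open import Data.Fin.Properties using (_<?_)
open import Data.Integer using (+_)
open import Data.Rational using (ℚ; 0ℚ; 1ℚ; _+_; _*_; _/_; _≤_)
open import Relation.Nullary using (yes; no)

-- Finite vertex set X = Fin n.
-- A mass on the 2-subsets of X is given by a function μ : Fin n → Fin n → ℚ,
-- where the unordered pair {i , j} with i < j carries the weight μ i j;
-- the values μ i j with i ≥ j are ignored.
Mass : ℕ → Set
Mass n = Fin n → Fin n → ℚ

-- weight of the unordered pair {i , j} (only used for i ≠ j)
w : ∀ {n} → Mass n → Fin n → Fin n → ℚ
w μ i j with i <? j
... | yes _ = μ i j
... | no  _ = μ j i

ΣF : ∀ n → (Fin n → ℚ) → ℚ
ΣF zero    f = 0ℚ
ΣF (suc n) f = f Fin.zero + ΣF n (λ i → f (Fin.suc i))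
  where import Data.Fin as Fin

ΣPairs : ∀ n → (Fin n → Fin n → ℚ) → ℚ
ΣPairs n f = ΣF n (λ i → ΣF n (λ j → if< i j (f i j)))
  where
  if< : Fin n → Fin n → ℚ → ℚ
  if< i j q with i <? j
  ... | yes _ = q
  ... | no  _ = 0ℚ

IsProbMass : ∀ {n} → Mass n → Set
IsProbMass {n} μ = (∀ i j → i < j → 0ℚ ≤ μ i j) × (ΣPairs n μ ≡ 1ℚ)
  where
  open import Data.Product using (_×_)
  open import Relation.Binary.PropositionalEquality using (_≡_)

_^ℚ_ : ℚ → ℕ → ℚ
q ^ℚ zero  = 1ℚ
q ^ℚ suc k = q * (q ^ℚ k)

μC4 : ∀ {n} → Mass n → Fin n → Fin n → Fin n → Fin n → ℚ
μC4 μ a b c d = w μ a b * (w μ b c * (w μ c d * w μ d a))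

ΣQuad : ∀ n → (Fin n → Fin n → Fin n → Fin n → ℚ) → ℚ
ΣQuad n f = ΣPairs n (λ a b → ΣPairs n (λ c d → if< b c (f a b c d)))
  where
  if< : Fin n → Fin n → ℚ → ℚ
  if< i j q with i <? j
  ... | yes _ = q
  ... | no  _ = 0ℚ

-- β_B(μ; C4, k) = Σ_{H' ∈ C(X, C4)} μ(H')^k.
-- The subgraphs of K_X isomorphic to C4 are in bijection with pairs
-- (4-set {a<b<c<d}, one of its three 4-cycles):
--   a-b-c-d-a ,  a-b-d-c-a ,  a-c-b-d-a .
βC4 : ∀ {n} → Mass n → ℕ → ℚ
βC4 {n} μ k = ΣQuad n (λ a b c d →
     (μC4 μ a b c d ^ℚ k) + ((μC4 μ a b d c ^ℚ k) + (μC4 μ a c b d ^ℚ k)))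

quarter : ℚ
quarter = + 1 / 4

{-# OPTIONS --safe #-}
module Submission where

-- For k = 1, regard the weighted count of 4-cycles as a polynomial in the edge weights, with total
-- weight 1. Its partial derivative G(xy) is the weight of the 3-edge paths joining x and y. Take xy
-- to be an edge of maximal weight m, let s be the weight of the other edges at x or y, and t ≤ 1 − m − s
-- that of the edges disjoint from xy. Then G(xy) ≤ min (m s² / 4 , t s² / 4 , m s t / 2) ≤ 1/64.
-- At a maximum of the polynomial no derivative exceeds G(xy), so Euler's identity 4 F = Σ μ(e) G(e)
-- gives F ≤ 1/256. As no maximum is available constructively, a weight δ is repeatedly moved from a
-- heaviest edge to an edge whose derivative is larger by at least δ: each move raises F by at least
-- δ², so the process stops, at a mass for which F ≤ 1/256 + O(δ).
--
-- For larger k, every 4-cycle has weight at most 1/256 by the case k = 1, so the k-th powers are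
-- bounded by 256^(1-k) times the weights themselves. Equality holds for the uniform mass on one C₄.

-- Maximality of m enters the derivative bound twice. In m s² / 4 it bounds the middle edge of a
-- path joining x and y; in m s t / 2 it bounds one of the end edges. Each of the three bounds alone
-- exceeds 1/64 for suitable m, s, t with m + s + t = 1. They agree at the uniform 4-cycle, where m
-- = t = 1/4 and s = 1/2, and these values of m and s are the thresholds of the case distinction.
--
-- A 4-cycle contains an edge at most once, so F is affine in each single weight. A move therefore
-- passes through an intermediate weight `V`, from which δ has been taken off the heaviest edge: the
-- weights before and after the move both arise from `V` by adding δ to one edge. With derivatives
-- taken at `V`, the change of F is exactly δ times their difference, without a second-order error.
--
-- Weights are symmetric matrices and sums run over ordered tuples. A probability mass then has
-- total 2, each 4-cycle is counted eight times, and 1/256 becomes 1/32. The order conditions of the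
-- enumeration are removed at the end, by choosing a starting vertex and a direction.

open import Defs

module FourCycles where

  open import Data.Empty using (⊥-elim)
  open import Data.Fin.Base using (Fin; zero; suc) renaming (_<_ to _<F_)
  open import Data.Fin.Properties using (any?; all?)
    renaming (_≟_ to _≟F_; _<?_ to _<?F_; <-trans to <F-trans; <-irrefl to <F-irrefl; <-asym to <F-asym; <-cmp to <F-cmp)
  import Data.Integer.Base as ℤ
  import Data.Integer.Properties as ℤ
  open import Data.Nat.Base as ℕ using (ℕ; zero; suc)
  import Data.Nat.Properties as ℕ
  open import Data.Product using (_×_; _,_; proj₁; proj₂; Σ; ∃)
  open import Data.Rational
  open import Data.Rational.Properties
  import Data.Rational.Unnormalised.Base as ℚᵘ
  import Data.Rational.Unnormalised.Properties as ℚᵘ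
  open import Data.Sum using (_⊎_; inj₁; inj₂)
  open import Function using (_∘_)
  open import Level using (0ℓ)
  open import Relation.Binary.Definitions using (tri<; tri≈; tri>)
  open import Relation.Binary.PropositionalEquality
  open import Relation.Nullary using (¬_; Dec; yes; no)
  open import Relation.Nullary.Decidable using (dec⇒maybe; _×-dec_; ¬?; toWitness)
  open import Tactic.RingSolver using (solve-∀)
  open import Tactic.RingSolver.Core.AlmostCommutativeRing
    using (AlmostCommutativeRing; fromCommutativeRing)

  -- Order arithmetic in the rationals

  ℚ-ring : AlmostCommutativeRing 0ℓ 0ℓ
  ℚ-ring = fromCommutativeRing +-*-commutativeRing (λ x → dec⇒maybe (0ℚ ≟ x))

  *-nonNeg : ∀ {p q} → 0ℚ ≤ p → 0ℚ ≤ q → 0ℚ ≤ p * q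
  *-nonNeg {p} {q} 0≤p 0≤q =
    nonNegative⁻¹ (p * q) {{nonNeg*nonNeg⇒nonNeg p {{nonNegative 0≤p}} q {{nonNegative 0≤q}}}}

  +-nonNeg : ∀ {p q} → 0ℚ ≤ p → 0ℚ ≤ q → 0ℚ ≤ p + q
  +-nonNeg = +-mono-≤

  *-monoˡ : ∀ {r p q} → 0ℚ ≤ r → p ≤ q → r * p ≤ r * q
  *-monoˡ {r} 0≤r = *-monoˡ-≤-nonNeg r {{nonNegative 0≤r}}

  *-monoʳ : ∀ {r p q} → 0ℚ ≤ r → p ≤ q → p * r ≤ q * r
  *-monoʳ {r} 0≤r = *-monoʳ-≤-nonNeg r {{nonNegative 0≤r}}

  *-mono : ∀ {p q r s} → 0ℚ ≤ q → 0ℚ ≤ r → p ≤ q → r ≤ s → p * r ≤ q * s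
  *-mono 0≤q 0≤r p≤q r≤s = ≤-trans (*-monoʳ 0≤r p≤q) (*-monoˡ 0≤q r≤s)

  ≤-by-slack : ∀ {p q} r → 0ℚ ≤ r → p + r ≡ q → p ≤ q
  ≤-by-slack {p} r 0≤r eq = subst₂ _≤_ (+-identityʳ p) eq (+-monoʳ-≤ p 0≤r)

  sub-nonNeg : ∀ {p q} → p ≤ q → 0ℚ ≤ q + - p
  sub-nonNeg {p} {q} p≤q = subst (_≤ q + - p) (+-inverseʳ p) (+-monoˡ-≤ (- p) p≤q)

  square-nonNeg : ∀ p → 0ℚ ≤ p * p
  square-nonNeg p with ≤-total 0ℚ p
  ... | inj₁ 0≤p = *-nonNeg 0≤p 0≤p
  ... | inj₂ p≤0 = subst (0ℚ ≤_) (neg-square p) (*-nonNeg 0≤-p 0≤-p)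
    where
    neg-square : ∀ x → - x * - x ≡ x * x
    neg-square = solve-∀ ℚ-ring
    0≤-p : 0ℚ ≤ - p
    0≤-p = neg-antimono-≤ p≤0

  -- Finite sums

  ΣF-cong : ∀ {n} {f g : Fin n → ℚ} → (∀ i → f i ≡ g i) → ΣF n f ≡ ΣF n g
  ΣF-cong {zero}  eq = refl
  ΣF-cong {suc n} eq = cong₂ _+_ (eq zero) (ΣF-cong (eq ∘ suc))

  ΣF-mono : ∀ {n} {f g : Fin n → ℚ} → (∀ i → f i ≤ g i) → ΣF n f ≤ ΣF n g
  ΣF-mono {zero}  le = ≤-refl
  ΣF-mono {suc n} le = +-mono-≤ (le zero) (ΣF-mono (le ∘ suc))

  ΣF-0 : ∀ {n} → ΣF n (λ _ → 0ℚ) ≡ 0ℚ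
  ΣF-0 {zero}  = refl
  ΣF-0 {suc n} = trans (+-identityˡ (ΣF n (λ _ → 0ℚ))) (ΣF-0 {n})

  ΣF-nonNeg : ∀ {n} {f : Fin n → ℚ} → (∀ i → 0ℚ ≤ f i) → 0ℚ ≤ ΣF n f
  ΣF-nonNeg {n} {f} le = subst (_≤ ΣF n f) (ΣF-0 {n}) (ΣF-mono le)

  +-interchange : ∀ a b c d → (a + b) + (c + d) ≡ (a + c) + (b + d)
  +-interchange = solve-∀ ℚ-ring

  ΣF-+ : ∀ {n} (f g : Fin n → ℚ) → ΣF n (λ i → f i + g i) ≡ ΣF n f + ΣF n g
  ΣF-+ {zero}  f g = refl
  ΣF-+ {suc n} f g = trans
    (cong (λ s → f zero + g zero + s) (ΣF-+ (f ∘ suc) (g ∘ suc)))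
    (+-interchange (f zero) (g zero) (ΣF n (f ∘ suc)) (ΣF n (g ∘ suc)))

  ΣF-*ˡ : ∀ {n} q (f : Fin n → ℚ) → ΣF n (λ i → q * f i) ≡ q * ΣF n f
  ΣF-*ˡ {zero}  q f = sym (*-zeroʳ q)
  ΣF-*ˡ {suc n} q f = trans
    (cong (λ s → q * f zero + s) (ΣF-*ˡ q (f ∘ suc)))
    (sym (*-distribˡ-+ q (f zero) (ΣF n (f ∘ suc))))

  ΣF-*ʳ : ∀ {n} q (f : Fin n → ℚ) → ΣF n (λ i → f i * q) ≡ ΣF n f * q
  ΣF-*ʳ {n} q f =
    trans (ΣF-cong (λ i → *-comm (f i) q)) (trans (ΣF-*ˡ q f) (*-comm q (ΣF n f)))

  ΣF-swap : ∀ {m n} (f : Fin m → Fin n → ℚ) →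
    ΣF m (λ i → ΣF n (f i)) ≡ ΣF n (λ j → ΣF m (λ i → f i j))
  ΣF-swap {zero}  {n} f = sym (ΣF-0 {n})
  ΣF-swap {suc m} {n} f = trans
    (cong (λ s → ΣF n (f zero) + s) (ΣF-swap (f ∘ suc)))
    (sym (ΣF-+ (f zero) (λ j → ΣF m (λ i → f (suc i) j))))

  term≤ΣF : ∀ {n} {f : Fin n → ℚ} → (∀ i → 0ℚ ≤ f i) → ∀ i → f i ≤ ΣF n f
  term≤ΣF {suc n} {f} 0≤f zero    =
    ≤-by-slack (ΣF n (f ∘ suc)) (ΣF-nonNeg (0≤f ∘ suc)) refl
  term≤ΣF {suc n} {f} 0≤f (suc i) = ≤-trans
    (term≤ΣF (0≤f ∘ suc) i)
    (≤-by-slack (f zero) (0≤f zero) (+-comm (ΣF n (f ∘ suc)) (f zero)))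

  two-terms≤ΣF : ∀ {n} {f : Fin n → ℚ} → (∀ i → 0ℚ ≤ f i) →
    ∀ {i j} → i ≢ j → f i + f j ≤ ΣF n f
  two-terms≤ΣF 0≤f {zero}  {zero}  i≢j = ⊥-elim (i≢j refl)
  two-terms≤ΣF {f = f} 0≤f {zero}  {suc j} i≢j =
    +-monoʳ-≤ (f zero) (term≤ΣF (0≤f ∘ suc) j)
  two-terms≤ΣF {suc n} {f} 0≤f {suc i} {zero}  i≢j =
    subst (_≤ ΣF (suc n) f) (+-comm (f zero) (f (suc i))) (+-monoʳ-≤ (f zero) (term≤ΣF (0≤f ∘ suc) i))
  two-terms≤ΣF {suc n} {f} 0≤f {suc i} {suc j} i≢j = ≤-trans
    (two-terms≤ΣF (0≤f ∘ suc) (i≢j ∘ cong suc))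
    (≤-by-slack (f zero) (0≤f zero) (+-comm (ΣF n (f ∘ suc)) (f zero)))

  argmax : ∀ {n} (f : Fin (suc n) → ℚ) → ∃ λ i → ∀ j → f j ≤ f i
  argmax {zero}  f = zero , λ { zero → ≤-refl }
  argmax {suc n} f with argmax (f ∘ suc)
  ... | i , max with ≤-total (f zero) (f (suc i))
  ...   | inj₁ le = suc i , λ { zero → le ; (suc j) → max j }
  ...   | inj₂ ge = zero  , λ { zero → ≤-refl ; (suc j) → ≤-trans (max j) ge }

  -- Indicators of equality and inequality

  eq : ∀ {n} → Fin n → Fin n → ℚ
  eq i j with i ≟F j
  ... | yes _ = 1ℚ
  ... | no  _ = 0ℚ

  ne : ∀ {n} → Fin n → Fin n → ℚ
  ne i j with i ≟F j
  ... | yes _ = 0ℚ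
  ... | no  _ = 1ℚ

  eq-refl : ∀ {n} (i : Fin n) → eq i i ≡ 1ℚ
  eq-refl i with i ≟F i
  ... | yes _   = refl
  ... | no  i≢i = ⊥-elim (i≢i refl)

  eq-≢ : ∀ {n} {i j : Fin n} → i ≢ j → eq i j ≡ 0ℚ
  eq-≢ {i = i} {j} i≢j with i ≟F j
  ... | yes i≡j = ⊥-elim (i≢j i≡j)
  ... | no  _   = refl

  ne-refl : ∀ {n} (i : Fin n) → ne i i ≡ 0ℚ
  ne-refl i with i ≟F i
  ... | yes _   = refl
  ... | no  i≢i = ⊥-elim (i≢i refl)

  ne-≢ : ∀ {n} {i j : Fin n} → i ≢ j → ne i j ≡ 1ℚ
  ne-≢ {i = i} {j} i≢j with i ≟F j
  ... | yes i≡j = ⊥-elim (i≢j i≡j)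
  ... | no  _   = refl

  ne-sym : ∀ {n} (i j : Fin n) → ne i j ≡ ne j i
  ne-sym i j with i ≟F j
  ... | yes refl = sym (ne-refl i)
  ... | no  i≢j  = sym (ne-≢ (i≢j ∘ sym))

  ne-nonNeg : ∀ {n} (i j : Fin n) → 0ℚ ≤ ne i j
  ne-nonNeg i j with i ≟F j
  ... | yes _ = ≤-refl
  ... | no  _ = nonNegative⁻¹ 1ℚ

  eq-suc : ∀ {n} (i j : Fin n) → eq (suc i) (suc j) ≡ eq i j
  eq-suc i j = go (i ≟F j)
    where
    go : Dec (i ≡ j) → eq (suc i) (suc j) ≡ eq i j
    go (yes refl) = trans (eq-refl (suc i)) (sym (eq-refl i))
    go (no i≢j)   = trans (eq-≢ {i = suc i} {suc j} λ { refl → i≢j refl }) (sym (eq-≢ i≢j))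

  ΣF-eq : ∀ {n} (k : Fin n) (f : Fin n → ℚ) → ΣF n (λ i → eq i k * f i) ≡ f k
  ΣF-eq {suc n} zero f = trans
    (cong₂ _+_ (*-identityˡ (f zero))
      (trans (ΣF-cong λ i → *-zeroˡ (f (suc i))) (ΣF-0 {n})))
    (+-identityʳ (f zero))
  ΣF-eq {suc n} (suc k) f = trans
    (cong₂ _+_ (*-zeroˡ (f zero)) (ΣF-cong λ i → cong (_* f (suc i)) (eq-suc i k)))
    (trans (+-identityˡ (ΣF n (λ i → eq i k * f (suc i)))) (ΣF-eq k (f ∘ suc)))

  -- Double and quadruple sums

  Σ₂ : ∀ n → (Fin n → Fin n → ℚ) → ℚ
  Σ₂ n f = ΣF n λ a → ΣF n λ b → f a b

  Σ₄ : ∀ n → (Fin n → Fin n → Fin n → Fin n → ℚ) → ℚ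
  Σ₄ n f = Σ₂ n λ a b → Σ₂ n λ c d → f a b c d

  module _ {n : ℕ} where

    Σ₂-cong : {f g : Fin n → Fin n → ℚ} → (∀ a b → f a b ≡ g a b) → Σ₂ n f ≡ Σ₂ n g
    Σ₂-cong eq = ΣF-cong λ a → ΣF-cong λ b → eq a b

    Σ₂-mono : {f g : Fin n → Fin n → ℚ} → (∀ a b → f a b ≤ g a b) → Σ₂ n f ≤ Σ₂ n g
    Σ₂-mono le = ΣF-mono λ a → ΣF-mono λ b → le a b

    Σ₂-nonNeg : {f : Fin n → Fin n → ℚ} → (∀ a b → 0ℚ ≤ f a b) → 0ℚ ≤ Σ₂ n f
    Σ₂-nonNeg le = ΣF-nonNeg λ a → ΣF-nonNeg λ b → le a b

    Σ₂-+ : (f g : Fin n → Fin n → ℚ) → Σ₂ n (λ a b → f a b + g a b) ≡ Σ₂ n f + Σ₂ n g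
    Σ₂-+ f g = trans (ΣF-cong λ a → ΣF-+ (f a) (g a)) (ΣF-+ (λ a → ΣF n (f a)) (λ a → ΣF n (g a)))

    Σ₂-*ˡ : ∀ q (f : Fin n → Fin n → ℚ) → Σ₂ n (λ a b → q * f a b) ≡ q * Σ₂ n f
    Σ₂-*ˡ q f = trans (ΣF-cong λ a → ΣF-*ˡ q (f a)) (ΣF-*ˡ q (λ a → ΣF n (f a)))

    Σ₄-cong : {f g : Fin n → Fin n → Fin n → Fin n → ℚ} →
      (∀ a b c d → f a b c d ≡ g a b c d) → Σ₄ n f ≡ Σ₄ n g
    Σ₄-cong eq = Σ₂-cong λ a b → Σ₂-cong λ c d → eq a b c d

    Σ₄-mono : {f g : Fin n → Fin n → Fin n → Fin n → ℚ} →
      (∀ a b c d → f a b c d ≤ g a b c d) → Σ₄ n f ≤ Σ₄ n g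
    Σ₄-mono le = Σ₂-mono λ a b → Σ₂-mono λ c d → le a b c d

    Σ₄-+ : (f g : Fin n → Fin n → Fin n → Fin n → ℚ) →
      Σ₄ n (λ a b c d → f a b c d + g a b c d) ≡ Σ₄ n f + Σ₄ n g
    Σ₄-+ f g = trans (Σ₂-cong λ a b → Σ₂-+ (f a b) (g a b))
                     (Σ₂-+ (λ a b → Σ₂ n (f a b)) (λ a b → Σ₂ n (g a b)))

    Σ₄-rotate : (f : Fin n → Fin n → Fin n → Fin n → ℚ) →
      Σ₄ n (λ a b c d → f b c d a) ≡ Σ₄ n f
    Σ₄-rotate f = trans
      (ΣF-swap (λ a b → Σ₂ n (λ c d → f b c d a)))
      (ΣF-cong λ b → trans
        (ΣF-swap (λ a c → ΣF n (λ d → f b c d a)))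
        (ΣF-cong λ c → ΣF-swap (λ a d → f b c d a)))

    -- Symmetric weights, the 4-cycle polynomial and its derivatives

    private variable V W : Mass n

    record IsWeight (V : Mass n) : Set where
      field
        symmetric : ∀ a b → V a b ≡ V b a
        loopless  : ∀ a → V a a ≡ 0ℚ
        0≤weight  : ∀ a b → 0ℚ ≤ V a b

    -- The weight of the path b c d a, provided a ≠ c and b ≠ d; the remaining coincidences are
    -- excluded by looplessness.
    path : Mass n → Fin n → Fin n → Fin n → Fin n → ℚ
    path V a b c d = ne a c * ne b d * (V b c * (V c d * V d a))

    gradient : Mass n → Fin n → Fin n → ℚ
    gradient V a b = Σ₂ n (path V a b)

    -- With `U` the indicator of an edge this is a directional derivative, with `U` equal to `V` it
    -- is the right side of Euler's identity. Keeping the arguments apart lets one rearrangement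
    -- serve both.
    pairing : (U V : Mass n) → ℚ
    pairing U V = Σ₂ n λ a b → U a b * gradient V a b

    -- Every 4-cycle is counted eight times.
    cycles : Mass n → ℚ
    cycles V = pairing V V

    pairing-Σ₄ : ∀ U V → pairing U V ≡ Σ₄ n (λ a b c d → U a b * path V a b c d)
    pairing-Σ₄ U V = Σ₂-cong λ a b → sym (Σ₂-*ˡ (U a b) (path V a b))

    -- Reversing a path interchanges its ends.
    gradient-sym : IsWeight V → ∀ a b → gradient V a b ≡ gradient V b a
    gradient-sym {V} wt a b = trans
      (Σ₂-cong λ c d → swapped c d)
      (ΣF-swap (λ c d → path V b a d c))
      where
      open IsWeight wt
      reverse : ∀ i j p q r → i * j * (p * (q * r)) ≡ j * i * (r * (q * p))
      reverse = solve-∀ ℚ-ring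
      swapped : ∀ c d → path V a b c d ≡ path V b a d c
      swapped c d = trans
        (reverse (ne a c) (ne b d) (V b c) (V c d) (V d a))
        (cong (ne b d * ne a c *_)
          (cong₂ _*_ (symmetric d a) (cong₂ _*_ (symmetric c d) (symmetric b c))))

    -- Changing the weight of a single edge

    module _ {x y : Fin n} (x≢y : x ≢ y) where

      edge : Mass n
      edge a b = eq a x * eq b y + eq a y * eq b x

      edge-cases : ∀ a b →
        (edge a b ≡ 0ℚ) ⊎ (edge a b ≡ 1ℚ × ((a ≡ x × b ≡ y) ⊎ (a ≡ y × b ≡ x)))
      edge-cases a b with a ≟F x | b ≟F y | a ≟F y | b ≟F x
      ... | yes refl | yes refl | yes a≡y | _      = ⊥-elim (x≢y a≡y)
      ... | yes refl | yes refl | no _    | yes _  = inj₂ (refl , inj₁ (refl , refl))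
      ... | yes refl | yes refl | no _    | no _   = inj₂ (refl , inj₁ (refl , refl))
      ... | yes refl | no _     | yes a≡y | _      = ⊥-elim (x≢y a≡y)
      ... | yes refl | no _     | no _    | yes _  = inj₁ refl
      ... | yes refl | no _     | no _    | no _   = inj₁ refl
      ... | no a≢x   | yes refl | yes _   | yes b≡x = ⊥-elim (x≢y (sym b≡x))
      ... | no a≢x   | no _     | yes refl | yes refl = inj₂ (refl , inj₂ (refl , refl))
      ... | no a≢x   | yes _    | yes _   | no _   = inj₁ refl
      ... | no a≢x   | no _     | yes _   | no _   = inj₁ refl
      ... | no a≢x   | yes _    | no _    | yes _  = inj₁ refl
      ... | no a≢x   | yes _    | no _    | no _   = inj₁ refl
      ... | no a≢x   | no _     | no _    | yes _  = inj₁ refl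
      ... | no a≢x   | no _     | no _    | no _   = inj₁ refl

      edge-support : ∀ a b →
        (edge a b ≡ 0ℚ) ⊎ ((a ≡ x × b ≡ y) ⊎ (a ≡ y × b ≡ x))
      edge-support a b with edge-cases a b
      ... | inj₁ e       = inj₁ e
      ... | inj₂ (_ , s) = inj₂ s

      edge-sym : ∀ a b → edge a b ≡ edge b a
      edge-sym a b = lemma (eq a x) (eq b y) (eq a y) (eq b x)
        where
        lemma : ∀ p q r s → p * q + r * s ≡ s * r + q * p
        lemma = solve-∀ ℚ-ring

      edge-loopless : ∀ a → edge a a ≡ 0ℚ
      edge-loopless a with edge-support a a
      ... | inj₁ e                      = e
      ... | inj₂ (inj₁ (refl , a≡y)) = ⊥-elim (x≢y a≡y)
      ... | inj₂ (inj₂ (refl , a≡x)) = ⊥-elim (x≢y (sym a≡x))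

      Σ₂-edge : ∀ (f : Fin n → Fin n → ℚ) → Σ₂ n (λ a b → edge a b * f a b) ≡ f x y + f y x
      Σ₂-edge f = trans
        (ΣF-cong λ a → begin
          ΣF n (λ b → edge a b * f a b)
            ≡⟨ ΣF-cong (λ b → split (eq a x) (eq b y) (eq a y) (eq b x) (f a b)) ⟩
          ΣF n (λ b → eq a x * (eq b y * f a b) + eq a y * (eq b x * f a b))
            ≡⟨ ΣF-+ (λ b → eq a x * (eq b y * f a b)) (λ b → eq a y * (eq b x * f a b)) ⟩
          ΣF n (λ b → eq a x * (eq b y * f a b)) + ΣF n (λ b → eq a y * (eq b x * f a b))
            ≡⟨ cong₂ _+_ (pick a x y) (pick a y x) ⟩
          eq a x * f a y + eq a y * f a x ∎)
        (trans (ΣF-+ (λ a → eq a x * f a y) (λ a → eq a y * f a x))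
               (cong₂ _+_ (ΣF-eq x (λ a → f a y)) (ΣF-eq y (λ a → f a x))))
        where
        open ≡-Reasoning
        split : ∀ p q r s t → (p * q + r * s) * t ≡ p * (q * t) + r * (s * t)
        split = solve-∀ ℚ-ring
        pick : ∀ a u v → ΣF n (λ b → eq a u * (eq b v * f a b)) ≡ eq a u * f a v
        pick a u v = trans (ΣF-*ˡ (eq a u) (λ b → eq b v * f a b)) (cong (eq a u *_) (ΣF-eq v (f a)))

      private
        0*ˡ : ∀ p q → p ≡ 0ℚ → p * q ≡ 0ℚ
        0*ˡ p q p≡0 = trans (cong (_* q) p≡0) (*-zeroˡ q)

        0*ʳ : ∀ p q → q ≡ 0ℚ → p * q ≡ 0ℚ
        0*ʳ p q q≡0 = trans (cong (p *_) q≡0) (*-zeroʳ p)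

      -- Two consecutive steps along the same pair return to the starting point.
      edge-consecutive : ∀ a b c → a ≢ c → edge a b * edge b c ≡ 0ℚ
      edge-consecutive a b c a≢c with edge-support a b | edge-support b c
      ... | inj₁ e | _ = 0*ˡ (edge a b) (edge b c) e
      ... | inj₂ _ | inj₁ e = 0*ʳ (edge a b) (edge b c) e
      ... | inj₂ (inj₁ (a≡x , b≡y)) | inj₂ (inj₁ (b≡x , c≡y)) = ⊥-elim (x≢y (trans (sym b≡x) b≡y))
      ... | inj₂ (inj₁ (a≡x , b≡y)) | inj₂ (inj₂ (b≡y′ , c≡x)) = ⊥-elim (a≢c (trans a≡x (sym c≡x)))
      ... | inj₂ (inj₂ (a≡y , b≡x)) | inj₂ (inj₁ (b≡x′ , c≡y)) = ⊥-elim (a≢c (trans a≡y (sym c≡y)))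
      ... | inj₂ (inj₂ (a≡y , b≡x)) | inj₂ (inj₂ (b≡y , c≡x)) = ⊥-elim (x≢y (trans (sym b≡x) b≡y))

      -- Since a ≠ c, the two steps would run through the pair in opposite directions; then b = c,
      -- and the edge linking them is a loop.
      edge-opposite : IsWeight V → ∀ a b c d → a ≢ c → edge a b * edge c d * V b c ≡ 0ℚ
      edge-opposite {V} wt a b c d a≢c with edge-support a b | edge-support c d
      ... | inj₁ e | _ = 0*ˡ (edge a b * edge c d) (V b c) (0*ˡ (edge a b) (edge c d) e)
      ... | inj₂ _ | inj₁ e = 0*ˡ (edge a b * edge c d) (V b c) (0*ʳ (edge a b) (edge c d) e)
      ... | inj₂ (inj₁ (a≡x , b≡y)) | inj₂ (inj₁ (c≡x , d≡y)) = ⊥-elim (a≢c (trans a≡x (sym c≡x)))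
      ... | inj₂ (inj₂ (a≡y , b≡x)) | inj₂ (inj₂ (c≡y , d≡x)) = ⊥-elim (a≢c (trans a≡y (sym c≡y)))
      ... | inj₂ (inj₁ (a≡x , refl)) | inj₂ (inj₂ (refl , d≡x)) =
        0*ʳ (edge a b * edge b d) (V b b) (IsWeight.loopless wt b)
      ... | inj₂ (inj₂ (a≡y , refl)) | inj₂ (inj₁ (refl , d≡y)) =
        0*ʳ (edge a b * edge b d) (V b b) (IsWeight.loopless wt b)

      private
        guarded : ∀ (a c : Fin n) {p} → (a ≢ c → p ≡ 0ℚ) → ne a c * p ≡ 0ℚ
        guarded a c {p} zero-if = go (a ≟F c)
          where
          go : Dec (a ≡ c) → ne a c * p ≡ 0ℚ
          go (yes refl) = 0*ˡ (ne a c) p (ne-refl a)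
          go (no a≢c)   = 0*ʳ (ne a c) p (zero-if a≢c)

        -- The terms of degree at least two in δ are grouped so that each carries one of six
        -- vanishing factors: four come from consecutive edges, two from opposite edges together
        -- with an edge linking them.
        expand : ∀ i j δ v₁ v₂ v₃ v₄ e₁ e₂ e₃ e₄ →
          i * j * ((v₁ + δ * e₁) * ((v₂ + δ * e₂) * ((v₃ + δ * e₃) * (v₄ + δ * e₄)))) ≡
          i * j * (v₁ * (v₂ * (v₃ * v₄)))
            + δ * (e₁ * (i * j * (v₂ * (v₃ * v₄))) + (e₂ * (j * i * (v₃ * (v₄ * v₁)))
                + (e₃ * (i * j * (v₄ * (v₁ * v₂))) + e₄ * (j * i * (v₁ * (v₂ * v₃))))))
            + (i * (e₁ * e₂) * (j * δ * δ * (v₃ + δ * e₃) * (v₄ + δ * e₄))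
              + j * (e₂ * e₃) * (i * δ * δ * v₁ * (v₄ + δ * e₄))
              + i * (e₃ * e₄) * (j * δ * δ * v₁ * v₂)
              + j * (e₄ * e₁) * (i * δ * δ * v₂ * v₃)
              + i * (e₁ * e₃ * v₂) * (j * δ * δ * (v₄ + δ * e₄))
              + j * (e₂ * e₄ * v₃) * (i * δ * δ * v₁))
        expand = solve-∀ ℚ-ring

        vanish : ∀ m z₁ z₂ z₃ z₄ z₅ z₆ r₁ r₂ r₃ r₄ r₅ r₆ →
          z₁ ≡ 0ℚ → z₂ ≡ 0ℚ → z₃ ≡ 0ℚ → z₄ ≡ 0ℚ → z₅ ≡ 0ℚ → z₆ ≡ 0ℚ →
          m + (z₁ * r₁ + z₂ * r₂ + z₃ * r₃ + z₄ * r₄ + z₅ * r₅ + z₆ * r₆) ≡ m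
        vanish m _ _ _ _ _ _ r₁ r₂ r₃ r₄ r₅ r₆ refl refl refl refl refl refl =
          zeros m r₁ r₂ r₃ r₄ r₅ r₆
          where
          zeros : ∀ m r₁ r₂ r₃ r₄ r₅ r₆ →
            m + (0ℚ * r₁ + 0ℚ * r₂ + 0ℚ * r₃ + 0ℚ * r₄ + 0ℚ * r₅ + 0ℚ * r₆) ≡ m
          zeros = solve-∀ ℚ-ring

      -- An identity rather than a first-order estimate, because no 4-cycle uses the edge xy twice.
      -- The factor 8 comes from the four positions of xy in a quadruple and its two orientations.
      cycles-shift : IsWeight V → ∀ δ → (∀ a b → W a b ≡ V a b + δ * edge a b) →
        cycles W ≡ cycles V + ℤ.+ 8 / 1 * δ * gradient V x y
      cycles-shift {V} {W} wt δ W≡ = begin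
        cycles W
          ≡⟨ pairing-Σ₄ W W ⟩
        Σ₄ n (λ a b c d → W a b * path W a b c d)
          ≡⟨ Σ₄-cong pointwise ⟩
        Σ₄ n (λ a b c d → V a b * path V a b c d + δ * (f a b c d + (f b c d a + (f c d a b + f d a b c))))
          ≡⟨ Σ₄-+ (λ a b c d → V a b * path V a b c d)
                  (λ a b c d → δ * (f a b c d + (f b c d a + (f c d a b + f d a b c)))) ⟩
        Σ₄ n (λ a b c d → V a b * path V a b c d) +
        Σ₄ n (λ a b c d → δ * (f a b c d + (f b c d a + (f c d a b + f d a b c))))
          ≡⟨ cong₂ _+_ (sym (pairing-Σ₄ V V)) rotations ⟩
        cycles V + δ * (S + (S + (S + S)))
          ≡⟨ cong (λ s → cycles V + δ * (s + (s + (s + s)))) S≡ ⟩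
        cycles V + δ * ((g + g) + ((g + g) + ((g + g) + (g + g))))
          ≡⟨ cong (cycles V +_) (eightfold δ g) ⟩
        cycles V + ℤ.+ 8 / 1 * δ * g ∎
        where
        open ≡-Reasoning
        g : ℚ
        g = gradient V x y

        f : Fin n → Fin n → Fin n → Fin n → ℚ
        f a b c d = edge a b * path V a b c d

        S : ℚ
        S = Σ₄ n f

        S≡ : S ≡ g + g
        S≡ = trans (sym (pairing-Σ₄ edge V))
          (trans (Σ₂-edge (gradient V)) (cong (g +_) (gradient-sym wt y x)))

        eightfold : ∀ δ g → δ * ((g + g) + ((g + g) + ((g + g) + (g + g)))) ≡ ℤ.+ 8 / 1 * δ * g
        eightfold = solve-∀ ℚ-ring

        rotate₂ : Σ₄ n (λ a b c d → f c d a b) ≡ S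
        rotate₂ = trans (Σ₄-rotate (λ a b c d → f b c d a)) (Σ₄-rotate f)

        rotate₃ : Σ₄ n (λ a b c d → f d a b c) ≡ S
        rotate₃ = trans (Σ₄-rotate (λ a b c d → f c d a b)) rotate₂

        rotations : Σ₄ n (λ a b c d → δ * (f a b c d + (f b c d a + (f c d a b + f d a b c))))
          ≡ δ * (S + (S + (S + S)))
        rotations = begin
          Σ₄ n (λ a b c d → δ * (f a b c d + (f b c d a + (f c d a b + f d a b c))))
            ≡⟨ Σ₂-cong (λ a b → Σ₂-*ˡ δ (λ c d → f a b c d + (f b c d a + (f c d a b + f d a b c)))) ⟩
          Σ₂ n (λ a b → δ * Σ₂ n (λ c d → f a b c d + (f b c d a + (f c d a b + f d a b c))))
            ≡⟨ Σ₂-*ˡ δ (λ a b → Σ₂ n (λ c d → f a b c d + (f b c d a + (f c d a b + f d a b c)))) ⟩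
          δ * Σ₄ n (λ a b c d → f a b c d + (f b c d a + (f c d a b + f d a b c)))
            ≡⟨ cong (δ *_) (trans
                 (Σ₄-+ f (λ a b c d → f b c d a + (f c d a b + f d a b c)))
                 (cong (S +_) (trans
                   (Σ₄-+ (λ a b c d → f b c d a) (λ a b c d → f c d a b + f d a b c))
                   (cong₂ _+_ (Σ₄-rotate f) (trans
                     (Σ₄-+ (λ a b c d → f c d a b) (λ a b c d → f d a b c))
                     (cong₂ _+_ rotate₂ rotate₃)))))) ⟩
          δ * (S + (S + (S + S))) ∎

        pointwise : ∀ a b c d → W a b * path W a b c d ≡
          V a b * path V a b c d + δ * (f a b c d + (f b c d a + (f c d a b + f d a b c)))
        pointwise a b c d
          rewrite W≡ a b | W≡ b c | W≡ c d | W≡ d a | ne-sym c a | ne-sym d b = begin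
          (V a b + δ * edge a b) * (i * j * ((V b c + δ * edge b c) * ((V c d + δ * edge c d) * (V d a + δ * edge d a))))
            ≡⟨ pull (V a b + δ * edge a b) (i * j)
                 ((V b c + δ * edge b c) * ((V c d + δ * edge c d) * (V d a + δ * edge d a))) ⟩
          i * j * ((V a b + δ * edge a b) * ((V b c + δ * edge b c) * ((V c d + δ * edge c d) * (V d a + δ * edge d a))))
            ≡⟨ expand i j δ (V a b) (V b c) (V c d) (V d a) (edge a b) (edge b c) (edge c d) (edge d a) ⟩
          _ ≡⟨ vanish main
                 (i * (edge a b * edge b c)) (j * (edge b c * edge c d))
                 (i * (edge c d * edge d a)) (j * (edge d a * edge a b))
                 (i * (edge a b * edge c d * V b c)) (j * (edge b c * edge d a * V c d))
                 (j * δ * δ * (V c d + δ * edge c d) * (V d a + δ * edge d a))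
                 (i * δ * δ * V a b * (V d a + δ * edge d a))
                 (j * δ * δ * V a b * V b c)
                 (i * δ * δ * V b c * V c d)
                 (j * δ * δ * (V d a + δ * edge d a))
                 (i * δ * δ * V a b)
                 (guarded a c (edge-consecutive a b c))
                 (guarded b d (edge-consecutive b c d))
                 (guarded a c (edge-consecutive c d a ∘ (_∘ sym)))
                 (guarded b d (edge-consecutive d a b ∘ (_∘ sym)))
                 (guarded a c (edge-opposite wt a b c d))
                 (guarded b d (edge-opposite wt b c d a)) ⟩
          main ≡⟨ cong (_+ rest) (sym (pull (V a b) (i * j) (V b c * (V c d * V d a)))) ⟩
          V a b * (i * j * (V b c * (V c d * V d a))) + rest ∎
          where
          i j rest main : ℚ
          i = ne a c
          j = ne b d
          rest = δ * (edge a b * (i * j * (V b c * (V c d * V d a))) + (edge b c * (j * i * (V c d * (V d a * V a b)))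
                + (edge c d * (i * j * (V d a * (V a b * V b c))) + edge d a * (j * i * (V a b * (V b c * V c d))))))
          main = i * j * (V a b * (V b c * (V c d * V d a))) + rest
          pull : ∀ u k p → u * (k * p) ≡ k * (u * p)
          pull = solve-∀ ℚ-ring

  -- Bounds on the derivative

  ΣF-*-ΣF : ∀ {m n} (f : Fin m → ℚ) (g : Fin n → ℚ) →
    ΣF m (λ i → ΣF n (λ j → f i * g j)) ≡ ΣF m f * ΣF n g
  ΣF-*-ΣF {m} {n} f g =
    trans (ΣF-cong λ i → ΣF-*ˡ (f i) g) (ΣF-*ʳ (ΣF n g) f)

  module GradientBounds {n : ℕ} {V : Mass n} (wt : IsWeight V) {x y : Fin n} (x≢y : x ≢ y) where
    open IsWeight wt

    nbr-x nbr-y : Fin n → ℚ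
    nbr-x d = ne d y * V x d
    nbr-y c = ne c x * V y c

    deg-x deg-y : ℚ
    deg-x = ΣF n nbr-x
    deg-y = ΣF n nbr-y

    away : Fin n → ℚ
    away c = ne c x * ne c y

    -- twice the weight of the edges disjoint from x and y
    rest : ℚ
    rest = Σ₂ n λ c d → away c * away d * V c d

    nbr-x≥0 : ∀ d → 0ℚ ≤ nbr-x d
    nbr-x≥0 d = *-nonNeg (ne-nonNeg d y) (0≤weight x d)

    nbr-y≥0 : ∀ c → 0ℚ ≤ nbr-y c
    nbr-y≥0 c = *-nonNeg (ne-nonNeg c x) (0≤weight y c)

    deg-x≥0 : 0ℚ ≤ deg-x
    deg-x≥0 = ΣF-nonNeg nbr-x≥0

    deg-y≥0 : 0ℚ ≤ deg-y
    deg-y≥0 = ΣF-nonNeg nbr-y≥0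

    away≥0 : ∀ c → 0ℚ ≤ away c
    away≥0 c = *-nonNeg (ne-nonNeg c x) (ne-nonNeg c y)

    rest≥0 : 0ℚ ≤ rest
    rest≥0 = Σ₂-nonNeg λ c d → *-nonNeg (*-nonNeg (away≥0 c) (away≥0 d)) (0≤weight c d)

    gradient-as-neighbours : gradient V x y ≡ Σ₂ n λ c d → V c d * (nbr-y c * nbr-x d)
    gradient-as-neighbours = Σ₂-cong λ c d → begin
      ne x c * ne y d * (V y c * (V c d * V d x))
        ≡⟨ cong₂ (λ p q → p * q * (V y c * (V c d * V d x))) (ne-sym x c) (ne-sym y d) ⟩
      ne c x * ne d y * (V y c * (V c d * V d x))
        ≡⟨ cong (λ v → ne c x * ne d y * (V y c * (V c d * v))) (symmetric d x) ⟩
      ne c x * ne d y * (V y c * (V c d * V x d))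
        ≡⟨ regroup (ne c x) (ne d y) (V y c) (V c d) (V x d) ⟩
      V c d * (nbr-y c * nbr-x d) ∎
      where
      open ≡-Reasoning
      regroup : ∀ p q r s t → p * q * (r * (s * t)) ≡ s * ((p * r) * (q * t))
      regroup = solve-∀ ℚ-ring

    -- Once the middle edge of every path is replaced by m, the two ends vary independently and the
    -- sum factors.
    gradient≤max*degrees : ∀ {m} → (∀ c d → V c d ≤ m) → gradient V x y ≤ m * (deg-y * deg-x)
    gradient≤max*degrees {m} V≤m = begin
      gradient V x y
        ≡⟨ gradient-as-neighbours ⟩
      Σ₂ n (λ c d → V c d * (nbr-y c * nbr-x d))
        ≤⟨ Σ₂-mono (λ c d → *-monoʳ (*-nonNeg (nbr-y≥0 c) (nbr-x≥0 d)) (V≤m c d)) ⟩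
      Σ₂ n (λ c d → m * (nbr-y c * nbr-x d))
        ≡⟨ Σ₂-*ˡ m (λ c d → nbr-y c * nbr-x d) ⟩
      m * Σ₂ n (λ c d → nbr-y c * nbr-x d)
        ≡⟨ cong (m *_) (ΣF-*-ΣF nbr-y nbr-x) ⟩
      m * (deg-y * deg-x) ∎
      where open ≤-Reasoning

    -- The pair {c, d} is the middle edge of two paths between x and y, one for each direction; this
    -- is the total weight of their end edges. Hence the doubled gradient in the bounds that follow.
    cross : Fin n → Fin n → ℚ
    cross c d = nbr-y c * nbr-x d + nbr-y d * nbr-x c

    double-gradient : gradient V x y + gradient V x y ≡ Σ₂ n λ c d → V c d * cross c d
    double-gradient = begin
      gradient V x y + gradient V x y
        ≡⟨ cong₂ _+_ gradient-as-neighbours (trans gradient-as-neighbours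
             (ΣF-swap λ c d → V c d * (nbr-y c * nbr-x d))) ⟩
      Σ₂ n (λ c d → V c d * (nbr-y c * nbr-x d)) + Σ₂ n (λ c d → V d c * (nbr-y d * nbr-x c))
        ≡⟨ sym (Σ₂-+ (λ c d → V c d * (nbr-y c * nbr-x d)) (λ c d → V d c * (nbr-y d * nbr-x c))) ⟩
      Σ₂ n (λ c d → V c d * (nbr-y c * nbr-x d) + V d c * (nbr-y d * nbr-x c))
        ≡⟨ Σ₂-cong (λ c d → trans
             (cong (λ v → V c d * (nbr-y c * nbr-x d) + v * (nbr-y d * nbr-x c)) (symmetric d c))
             (sym (*-distribˡ-+ (V c d) (nbr-y c * nbr-x d) (nbr-y d * nbr-x c)))) ⟩
      Σ₂ n (λ c d → V c d * cross c d) ∎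
      where open ≡-Reasoning

    private
      -- At c = x and c = y one neighbour weight is masked and the other is that of a loop, so no
      -- path has such a c as an inner vertex.
      away-cases : ∀ c → away c ≡ 1ℚ ⊎ (nbr-x c ≡ 0ℚ × nbr-y c ≡ 0ℚ)
      away-cases c with c ≟F x | c ≟F y
      ... | yes refl | yes x≡y = ⊥-elim (x≢y x≡y)
      ... | yes refl | no _ =
        inj₂ (trans (*-identityˡ (V x x)) (loopless x) , *-zeroˡ (V y x))
      ... | no _ | yes refl =
        inj₂ (*-zeroˡ (V x y) , trans (*-identityˡ (V y y)) (loopless y))
      ... | no _ | no _ = inj₁ refl

    -- Only edges disjoint from x and y occur as middle edges, and `rest` is their doubled weight;
    -- it remains to bound the coefficient of each. Three choices of `K` follow.
    double-gradient≤rest*bound : ∀ {K} → 0ℚ ≤ K → (∀ c d → c ≢ d → cross c d ≤ K) →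
      gradient V x y + gradient V x y ≤ K * rest
    double-gradient≤rest*bound {K} 0≤K cross≤K = begin
      gradient V x y + gradient V x y
        ≡⟨ double-gradient ⟩
      Σ₂ n (λ c d → V c d * cross c d)
        ≤⟨ Σ₂-mono pointwise ⟩
      Σ₂ n (λ c d → K * (away c * away d * V c d))
        ≡⟨ Σ₂-*ˡ K (λ c d → away c * away d * V c d) ⟩
      K * rest ∎
      where
      open ≤-Reasoning

      bounded : ∀ c d → 0ℚ ≤ K * (away c * away d * V c d)
      bounded c d = *-nonNeg 0≤K (*-nonNeg (*-nonNeg (away≥0 c) (away≥0 d)) (0≤weight c d))

      zeroˡ : ∀ v p q → v * (0ℚ * p + q * 0ℚ) ≡ 0ℚ
      zeroˡ = solve-∀ ℚ-ring

      zeroʳ : ∀ v p q → v * (p * 0ℚ + 0ℚ * q) ≡ 0ℚ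
      zeroʳ = solve-∀ ℚ-ring

      ones : ∀ v k → v * k ≡ k * (1ℚ * 1ℚ * v)
      ones = solve-∀ ℚ-ring

      off-diagonal : ∀ c d → c ≢ d → V c d * cross c d ≤ K * (away c * away d * V c d)
      off-diagonal c d c≢d with away-cases c | away-cases d
      ... | inj₂ (px , py) | _ = subst (_≤ K * (away c * away d * V c d))
        (sym (trans (cong₂ (λ p q → V c d * (q * nbr-x d + nbr-y d * p)) px py)
          (zeroˡ (V c d) (nbr-x d) (nbr-y d)))) (bounded c d)
      ... | inj₁ _ | inj₂ (px , py) = subst (_≤ K * (away c * away d * V c d))
        (sym (trans (cong₂ (λ p q → V c d * (nbr-y c * p + q * nbr-x c)) px py)
          (zeroʳ (V c d) (nbr-y c) (nbr-x c)))) (bounded c d)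
      ... | inj₁ pc | inj₁ pd = subst (V c d * cross c d ≤_)
        (trans (ones (V c d) K) (cong₂ (λ p q → K * (p * q * V c d)) (sym pc) (sym pd)))
        (*-monoˡ (0≤weight c d) (cross≤K c d c≢d))

      pointwise : ∀ c d → V c d * cross c d ≤ K * (away c * away d * V c d)
      pointwise c d with c ≟F d
      ... | no c≢d   = off-diagonal c d c≢d
      ... | yes refl = subst (_≤ K * (away c * away c * V c c))
        (sym (trans (cong (_* cross c c) (loopless c)) (*-zeroˡ (cross c c)))) (bounded c c)

    -- The two missing products, with equal arguments, complete `cross c d` to a product of partial
    -- sums of the degrees.
    cross≤degrees : ∀ c d → c ≢ d → cross c d ≤ deg-y * deg-x
    cross≤degrees c d c≢d = ≤-trans
      (≤-by-slack (nbr-y c * nbr-x c + nbr-y d * nbr-x d)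
        (+-nonNeg (*-nonNeg (nbr-y≥0 c) (nbr-x≥0 c)) (*-nonNeg (nbr-y≥0 d) (nbr-x≥0 d)))
        (factor (nbr-y c) (nbr-y d) (nbr-x c) (nbr-x d)))
      (*-mono deg-y≥0 (+-nonNeg (nbr-x≥0 c) (nbr-x≥0 d))
        (two-terms≤ΣF nbr-y≥0 c≢d) (two-terms≤ΣF nbr-x≥0 c≢d))
      where
      factor : ∀ p q r s → p * s + q * r + (p * r + q * s) ≡ (p + q) * (r + s)
      factor = solve-∀ ℚ-ring

    private
      ne*≤ : ∀ (i j : Fin n) {v} → 0ℚ ≤ v → ne i j * v ≤ v
      ne*≤ i j {v} 0≤v with i ≟F j
      ... | yes _ = subst (_≤ v) (sym (*-zeroˡ v)) 0≤v
      ... | no  _ = ≤-reflexive (*-identityˡ v)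

    -- In both paths the end edge at y weighs at most m, and the two end edges at x are distinct
    -- terms of `deg-x`.
    cross≤max*deg-x : ∀ {m} → (∀ c d → V c d ≤ m) → ∀ c d → c ≢ d → cross c d ≤ m * deg-x
    cross≤max*deg-x {m} V≤m c d c≢d = begin
      nbr-y c * nbr-x d + nbr-y d * nbr-x c
        ≤⟨ +-mono-≤ (*-monoʳ (nbr-x≥0 d) (nbr-y≤m c)) (*-monoʳ (nbr-x≥0 c) (nbr-y≤m d)) ⟩
      m * nbr-x d + m * nbr-x c
        ≡⟨ sym (*-distribˡ-+ m (nbr-x d) (nbr-x c)) ⟩
      m * (nbr-x d + nbr-x c)
        ≤⟨ *-monoˡ (≤-trans (0≤weight x x) (V≤m x x)) (two-terms≤ΣF nbr-x≥0 (c≢d ∘ sym)) ⟩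
      m * deg-x ∎
      where
      open ≤-Reasoning
      nbr-y≤m : ∀ c → nbr-y c ≤ m
      nbr-y≤m c = ≤-trans (ne*≤ c x (0≤weight y c)) (V≤m y c)

    cross≤max*deg-y : ∀ {m} → (∀ c d → V c d ≤ m) → ∀ c d → c ≢ d → cross c d ≤ m * deg-y
    cross≤max*deg-y {m} V≤m c d c≢d = begin
      nbr-y c * nbr-x d + nbr-y d * nbr-x c
        ≤⟨ +-mono-≤ (*-monoˡ (nbr-y≥0 c) (nbr-x≤m d)) (*-monoˡ (nbr-y≥0 d) (nbr-x≤m c)) ⟩
      nbr-y c * m + nbr-y d * m
        ≡⟨ factor (nbr-y c) (nbr-y d) m ⟩
      m * (nbr-y c + nbr-y d)
        ≤⟨ *-monoˡ (≤-trans (0≤weight x x) (V≤m x x)) (two-terms≤ΣF nbr-y≥0 c≢d) ⟩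
      m * deg-y ∎
      where
      open ≤-Reasoning
      factor : ∀ p q m → p * m + q * m ≡ m * (p + q)
      factor = solve-∀ ℚ-ring
      nbr-x≤m : ∀ d → nbr-x d ≤ m
      nbr-x≤m d = ≤-trans (ne*≤ d y (0≤weight x d)) (V≤m x d)

    -- Writing 1 as `at + away` in both indices cuts the matrix into four blocks: two mixed ones
    -- holding the edges that meet xy in one vertex, `rest`, and a corner holding xy twice.
    total-decomposition : Σ₂ n V ≡ (deg-x + deg-y) + (deg-x + deg-y) + rest + (V x y + V x y)
    total-decomposition = begin
      Σ₂ n V
        ≡⟨ Σ₂-cong pointwise ⟩
      Σ₂ n (λ c d → at c * (away d * V c d) + at d * (away c * V c d)
                    + (away c * away d * V c d + at c * (at d * V c d)))
        ≡⟨ trans (Σ₂-+ (λ c d → at c * (away d * V c d) + at d * (away c * V c d))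
                       (λ c d → away c * away d * V c d + at c * (at d * V c d)))
             (cong₂ _+_
               (Σ₂-+ (λ c d → at c * (away d * V c d)) (λ c d → at d * (away c * V c d)))
               (Σ₂-+ (λ c d → away c * away d * V c d) (λ c d → at c * (at d * V c d)))) ⟩
      Σ₂ n (λ c d → at c * (away d * V c d)) + Σ₂ n (λ c d → at d * (away c * V c d))
        + (rest + Σ₂ n (λ c d → at c * (at d * V c d)))
        ≡⟨ cong₂ _+_ (cong₂ _+_ rows columns) (cong (rest +_) corners) ⟩
      (deg-x + deg-y) + (deg-x + deg-y) + (rest + (V x y + V x y))
        ≡⟨ sym (+-assoc ((deg-x + deg-y) + (deg-x + deg-y)) rest (V x y + V x y)) ⟩
      (deg-x + deg-y) + (deg-x + deg-y) + rest + (V x y + V x y) ∎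
      where
      open ≡-Reasoning

      at : Fin n → ℚ
      at c = eq c x + eq c y

      at+away : ∀ c → at c + away c ≡ 1ℚ
      at+away c with c ≟F x | c ≟F y
      ... | yes refl | yes x≡y = ⊥-elim (x≢y x≡y)
      ... | yes _ | no _  = refl
      ... | no _  | yes _ = refl
      ... | no _  | no _  = refl

      distribute : ∀ p q r s v → (p + q) * ((r + s) * v) ≡
        p * (s * v) + r * (q * v) + (q * s * v + p * (r * v))
      distribute = solve-∀ ℚ-ring

      pointwise : ∀ c d → V c d ≡ at c * (away d * V c d) + at d * (away c * V c d)
                    + (away c * away d * V c d + at c * (at d * V c d))
      pointwise c d = begin
        V c d               ≡⟨ sym (trans (*-identityˡ (1ℚ * V c d)) (*-identityˡ (V c d))) ⟩
        1ℚ * (1ℚ * V c d)   ≡⟨ cong₂ (λ p q → p * (q * V c d)) (sym (at+away c)) (sym (at+away d)) ⟩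
        (at c + away c) * ((at d + away d) * V c d)
          ≡⟨ distribute (at c) (away c) (at d) (away d) (V c d) ⟩
        _ ∎

      ΣF-at : ∀ (h : Fin n → ℚ) → ΣF n (λ c → at c * h c) ≡ h x + h y
      ΣF-at h = trans (ΣF-cong λ c → *-distribʳ-+ (h c) (eq c x) (eq c y))
        (trans (ΣF-+ (λ c → eq c x * h c) (λ c → eq c y * h c)) (cong₂ _+_ (ΣF-eq x h) (ΣF-eq y h)))

      row-x : ∀ d → away d * V x d ≡ nbr-x d
      row-x d with d ≟F x
      ... | no _     = cong (_* V x d) (*-identityˡ (ne d y))
      ... | yes refl = trans (cong (0ℚ * ne x y *_) (loopless x))
        (trans (*-zeroʳ (0ℚ * ne x y)) (sym (trans (cong (ne x y *_) (loopless x)) (*-zeroʳ (ne x y)))))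

      row-y : ∀ d → away d * V y d ≡ nbr-y d
      row-y d with d ≟F y
      ... | no _     = cong (_* V y d) (*-identityʳ (ne d x))
      ... | yes refl = trans (cong (ne y x * 0ℚ *_) (loopless y))
        (trans (*-zeroʳ (ne y x * 0ℚ)) (sym (trans (cong (ne y x *_) (loopless y)) (*-zeroʳ (ne y x)))))

      rows : Σ₂ n (λ c d → at c * (away d * V c d)) ≡ deg-x + deg-y
      rows = trans (ΣF-cong λ c → ΣF-*ˡ (at c) (λ d → away d * V c d))
        (trans (ΣF-at (λ c → ΣF n (λ d → away d * V c d)))
          (cong₂ _+_ (ΣF-cong row-x) (ΣF-cong row-y)))

      columns : Σ₂ n (λ c d → at d * (away c * V c d)) ≡ deg-x + deg-y
      columns = trans (ΣF-swap (λ c d → at d * (away c * V c d)))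
        (trans (Σ₂-cong λ d c → cong (λ v → at d * (away c * v)) (symmetric c d)) rows)

      corners : Σ₂ n (λ c d → at c * (at d * V c d)) ≡ V x y + V x y
      corners = begin
        Σ₂ n (λ c d → at c * (at d * V c d))
          ≡⟨ ΣF-cong (λ c → ΣF-*ˡ (at c) (λ d → at d * V c d)) ⟩
        ΣF n (λ c → at c * ΣF n (λ d → at d * V c d))
          ≡⟨ ΣF-at (λ c → ΣF n (λ d → at d * V c d)) ⟩
        ΣF n (λ d → at d * V x d) + ΣF n (λ d → at d * V y d)
          ≡⟨ cong₂ _+_ (ΣF-at (V x)) (ΣF-at (V y)) ⟩
        (V x x + V x y) + (V y x + V y y)
          ≡⟨ cong₂ _+_ (trans (cong (_+ V x y) (loopless x)) (+-identityˡ (V x y)))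
               (trans (cong₂ _+_ (symmetric y x) (loopless y)) (+-identityʳ (V x y))) ⟩
        V x y + V x y ∎

  -- The Archimedean property

  fromℕ : ℕ → ℚ
  fromℕ k = ℤ.+ k / 1

  fromℕ-suc : ∀ k → fromℕ (suc k) ≡ 1ℚ + fromℕ k
  fromℕ-suc k = toℚᵘ-injective (begin
    toℚᵘ (fromℕ (suc k))             ≈⟨ toℚᵘ-fromℚᵘ (ℚᵘ.mkℚᵘ (ℤ.+ suc k) 0) ⟩
    ℚᵘ.mkℚᵘ (ℤ.+ suc k) 0            ≈⟨ ℚᵘ.≃-reflexive (cong (λ z → ℚᵘ.mkℚᵘ (ℤ.1ℤ ℤ.+ z) 0) (sym (ℤ.*-identityʳ (ℤ.+ k)))) ⟩
    toℚᵘ 1ℚ ℚᵘ.+ ℚᵘ.mkℚᵘ (ℤ.+ k) 0   ≈⟨ ℚᵘ.+-congʳ (toℚᵘ 1ℚ) (ℚᵘ.≃-sym (toℚᵘ-fromℚᵘ (ℚᵘ.mkℚᵘ (ℤ.+ k) 0))) ⟩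
    toℚᵘ 1ℚ ℚᵘ.+ toℚᵘ (fromℕ k)      ≈⟨ ℚᵘ.≃-sym (toℚᵘ-homo-+ 1ℚ (fromℕ k)) ⟩
    toℚᵘ (1ℚ + fromℕ k)              ∎)
    where open import Relation.Binary.Reasoning.Setoid ℚᵘ.≃-setoid

  -- The denominator of c serves as k, since the product is then the numerator.
  archimedean : ∀ c → 0ℚ < c → ∃ λ k → 1ℚ ≤ fromℕ k * c
  archimedean c 0<c with positive 0<c
  archimedean c@(mkℚ ℤ.+[1+ m ] d-1 _) 0<c | _ = suc d-1 , toℚᵘ-cancel-≤
    (ℚᵘ.≤-respʳ-≃ (ℚᵘ.≃-trans
        (ℚᵘ.*-congʳ {ℚᵘ.mkℚᵘ ℤ.+[1+ m ] d-1} (ℚᵘ.≃-sym (toℚᵘ-fromℚᵘ (ℚᵘ.mkℚᵘ (ℤ.+ suc d-1) 0))))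
        (ℚᵘ.≃-sym (toℚᵘ-homo-* (fromℕ (suc d-1)) c)))
      (ℚᵘ.*≤* {p = toℚᵘ 1ℚ} (ℤ.+≤+ bound)))
    where
    bound : 1 ℕ.* (1 ℕ.* suc d-1) ℕ.≤ suc d-1 ℕ.* suc m ℕ.* 1
    bound = subst₂ ℕ._≤_
      (sym (trans (ℕ.*-identityˡ (1 ℕ.* suc d-1)) (ℕ.*-identityˡ (suc d-1)))) (sym (ℕ.*-identityʳ (suc d-1 ℕ.* suc m)))
      (ℕ.m≤m*n (suc d-1) (suc m))

  -- Optimising the three bounds on a derivative

  private
    2ℚ 4ℚ 8ℚ : ℚ
    2ℚ = ℤ.+ 2 / 1
    4ℚ = ℤ.+ 4 / 1
    8ℚ = ℤ.+ 8 / 1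

  four-products≤square : ∀ p q → 4ℚ * (q * p) ≤ (p + q) * (p + q)
  four-products≤square p q =
    ≤-by-slack ((p + - q) * (p + - q)) (square-nonNeg (p + - q)) (identity p q)
    where
    identity : ∀ p q → 4ℚ * (q * p) + (p + - q) * (p + - q) ≡ (p + q) * (p + q)
    identity = solve-∀ ℚ-ring

  1/64ℚ : ℚ
  1/64ℚ = ℤ.+ 1 / 64

  private
    ≤1/64-by-4 : ∀ {g} → 4ℚ * g ≤ ℤ.+ 1 / 16 → g ≤ 1/64ℚ
    ≤1/64-by-4 le = *-cancelˡ-≤-pos 4ℚ le

    ≤1/64-by-8 : ∀ {g} → 8ℚ * g ≤ ℤ.+ 1 / 8 → g ≤ 1/64ℚ
    ≤1/64-by-8 le = *-cancelˡ-≤-pos 8ℚ le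

  -- Here p and q are the degrees and t is twice the disjoint weight. For m ≥ 1/4 the bound with q p
  -- t decides, for small m and s = p + q the bound m q p, and for s ≥ 1/2 the sum of the last two,
  -- in which p and q enter only through s.
  gradient-arithmetic : ∀ {m g p q t} → 0ℚ ≤ m → 0ℚ ≤ p → 0ℚ ≤ q → 0ℚ ≤ t →
    t ≡ ℤ.+ 2 / 1 + - (m + m) + - ((p + q) + (p + q)) →
    g ≤ m * (q * p) → g + g ≤ q * p * t → g + g ≤ m * p * t → g + g ≤ m * q * t →
    g ≤ 1/64ℚ
  gradient-arithmetic {m} {g} {p} {q} {t} 0≤m 0≤p 0≤q 0≤t t≡ g≤mqp 2g≤qpt 2g≤mpt 2g≤mqt
    with ≤-total (ℤ.+ 1 / 4) m | ≤-total (p + q) ½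
  ... | inj₁ 1/4≤m | _ = ≤1/64-by-8 (begin
    8ℚ * g                ≡⟨ double g ⟩
    4ℚ * (g + g)          ≤⟨ *-monoˡ (nonNegative⁻¹ 4ℚ) 2g≤qpt ⟩
    4ℚ * (q * p * t)      ≡⟨ sym (*-assoc 4ℚ (q * p) t) ⟩
    4ℚ * (q * p) * t      ≤⟨ *-monoʳ 0≤t (four-products≤square p q) ⟩
    s * s * t             ≤⟨ ≤-by-slack
                               excess
                               (*-nonNeg (nonNegative⁻¹ (ℤ.+ 2 / 1)) (+-nonNeg
                                 (*-nonNeg (sub-nonNeg 1/4≤m) (square-nonNeg s))
                                 (*-nonNeg (square-nonNeg (s + - ½))
                                   (+-nonNeg 0≤s (nonNegative⁻¹ (ℤ.+ 1 / 4))))))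
                               (trans (cong (λ r → s * s * r + excess) t≡) (slack m s)) ⟩
    ℤ.+ 1 / 8             ∎)
    where
    open ≤-Reasoning
    s : ℚ
    s = p + q
    0≤s : 0ℚ ≤ s
    0≤s = +-nonNeg 0≤p 0≤q
    excess : ℚ
    -- For m = 1/4 the bound is s² (3/2 - 2 s), with maximum 1/8 at s = 1/2: this gives the square
    -- of s - 1/2. The other summand is the loss for larger m.
    excess = ℤ.+ 2 / 1 * ((m + - (ℤ.+ 1 / 4)) * (s * s) + (s + - ½) * (s + - ½) * (s + ℤ.+ 1 / 4))
    double : ∀ g → 8ℚ * g ≡ 4ℚ * (g + g)
    double = solve-∀ ℚ-ring
    slack : ∀ m s → s * s * (ℤ.+ 2 / 1 + - (m + m) + - (s + s))
      + ℤ.+ 2 / 1 * ((m + - (ℤ.+ 1 / 4)) * (s * s) + (s + - ½) * (s + - ½) * (s + ℤ.+ 1 / 4))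
      ≡ ℤ.+ 1 / 8
    slack = solve-∀ ℚ-ring
  ... | inj₂ m≤1/4 | inj₁ s≤½ = ≤1/64-by-4 (begin
    4ℚ * g                ≤⟨ *-monoˡ (nonNegative⁻¹ 4ℚ) g≤mqp ⟩
    4ℚ * (m * (q * p))    ≡⟨ swap 4ℚ m (q * p) ⟩
    m * (4ℚ * (q * p))    ≤⟨ *-monoˡ 0≤m (four-products≤square p q) ⟩
    m * (s * s)           ≤⟨ *-mono (nonNegative⁻¹ (ℤ.+ 1 / 4)) (square-nonNeg s) m≤1/4
                               (*-mono (nonNegative⁻¹ ½) 0≤s s≤½ s≤½) ⟩
    ℤ.+ 1 / 16            ∎)
    where
    open ≤-Reasoning
    s : ℚ
    s = p + q
    0≤s : 0ℚ ≤ s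
    0≤s = +-nonNeg 0≤p 0≤q
    swap : ∀ i j k → i * (j * k) ≡ j * (i * k)
    swap = solve-∀ ℚ-ring
  ... | inj₂ m≤1/4 | inj₂ ½≤s = ≤1/64-by-4 (begin
    4ℚ * g                  ≡⟨ double g ⟩
    (g + g) + (g + g)       ≤⟨ +-mono-≤ 2g≤mpt 2g≤mqt ⟩
    m * p * t + m * q * t   ≡⟨ factor m p q t ⟩
    m * s * t               ≤⟨ ≤-by-slack
                                 excess
                                 (+-nonNeg
                                   (*-nonNeg (nonNegative⁻¹ (ℤ.+ 2 / 1)) (*-nonNeg 0≤m
                                     (*-nonNeg (sub-nonNeg ½≤s) (+-nonNeg (sub-nonNeg ½≤s) 0≤m))))
                                   (square-nonNeg (m + - (ℤ.+ 1 / 4))))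
                                 (trans (cong (λ r → m * s * r + excess) t≡) (slack m s)) ⟩
    ℤ.+ 1 / 16              ∎)
    where
    open ≤-Reasoning
    s excess : ℚ
    s = p + q
    -- The first summand is the loss against s = 1/2. There the bound is m (1/2 - m), which falls
    -- short of 1/16 by the square of m - 1/4.
    excess = ℤ.+ 2 / 1 * (m * ((s + - ½) * (s + - ½ + m))) + (m + - (ℤ.+ 1 / 4)) * (m + - (ℤ.+ 1 / 4))
    double : ∀ g → 4ℚ * g ≡ (g + g) + (g + g)
    double = solve-∀ ℚ-ring
    factor : ∀ m p q t → m * p * t + m * q * t ≡ m * (p + q) * t
    factor = solve-∀ ℚ-ring
    slack : ∀ m s → m * s * (ℤ.+ 2 / 1 + - (m + m) + - (s + s))
      + (ℤ.+ 2 / 1 * (m * ((s + - ½) * (s + - ½ + m))) + (m + - (ℤ.+ 1 / 4)) * (m + - (ℤ.+ 1 / 4)))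
      ≡ ℤ.+ 1 / 16
    slack = solve-∀ ℚ-ring

  module _ {n : ℕ} {V : Mass n} (wt : IsWeight V) {x y : Fin n} (x≢y : x ≢ y) where
    open IsWeight wt
    open GradientBounds wt x≢y

    -- The equation says that the total would be 2 if xy had weight m, and makes `rest` equal to 2 -
    -- 2 m - 2 s. It fits the intermediate weight of a move: xy has lost δ there, while m is still
    -- its former weight.
    gradient≤1/64 : ∀ {m} → (∀ c d → V c d ≤ m) →
      Σ₂ n V + (m + m) ≡ ℤ.+ 2 / 1 + (V x y + V x y) → gradient V x y ≤ 1/64ℚ
    gradient≤1/64 {m} V≤m total = gradient-arithmetic 0≤m deg-x≥0 deg-y≥0 rest≥0 rest≡
      (gradient≤max*degrees V≤m)
      (double-gradient≤rest*bound (*-nonNeg deg-y≥0 deg-x≥0) cross≤degrees)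
      (double-gradient≤rest*bound (*-nonNeg 0≤m deg-x≥0) (cross≤max*deg-x V≤m))
      (double-gradient≤rest*bound (*-nonNeg 0≤m deg-y≥0) (cross≤max*deg-y V≤m))
      where
      open ≡-Reasoning
      s v : ℚ
      s = deg-x + deg-y
      v = V x y
      0≤m : 0ℚ ≤ m
      0≤m = ≤-trans (0≤weight x x) (V≤m x x)
      solve-rest : ∀ s t v m → t ≡ (s + s + t + (v + v)) + (m + m) + - (v + v) + - (m + m) + - (s + s)
      solve-rest = solve-∀ ℚ-ring
      cancel : ∀ k s v m → k + (v + v) + - (v + v) + - (m + m) + - (s + s) ≡ k + - (m + m) + - (s + s)
      cancel = solve-∀ ℚ-ring
      rest≡ : rest ≡ ℤ.+ 2 / 1 + - (m + m) + - (s + s)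
      rest≡ = begin
        rest
          ≡⟨ solve-rest s rest v m ⟩
        (s + s + rest + (v + v)) + (m + m) + - (v + v) + - (m + m) + - (s + s)
          ≡⟨ cong (λ r → r + (m + m) + - (v + v) + - (m + m) + - (s + s)) (sym total-decomposition) ⟩
        Σ₂ n V + (m + m) + - (v + v) + - (m + m) + - (s + s)
          ≡⟨ cong (λ r → r + - (v + v) + - (m + m) + - (s + s)) total ⟩
        ℤ.+ 2 / 1 + (v + v) + - (v + v) + - (m + m) + - (s + s)
          ≡⟨ cancel (ℤ.+ 2 / 1) s v m ⟩
        ℤ.+ 2 / 1 + - (m + m) + - (s + s) ∎

    degrees≤1 : Σ₂ n V ≤ ℤ.+ 2 / 1 → deg-x + deg-y ≤ 1ℚ
    degrees≤1 total = *-cancelˡ-≤-pos (ℤ.+ 2 / 1) (≤-trans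
      (≤-by-slack (rest + (V x y + V x y))
        (+-nonNeg rest≥0 (+-nonNeg (0≤weight x y) (0≤weight x y)))
        (trans (double (deg-x + deg-y) rest (V x y + V x y)) (sym total-decomposition)))
      total)
      where
      double : ∀ s t v → ℤ.+ 2 / 1 * s + (t + v) ≡ s + s + t + v
      double = solve-∀ ℚ-ring

    -- The bound m s² / 4 with s ≤ 1. It supplies a ceiling for the ascent and settles the case of a
    -- light heaviest edge.
    four-gradient≤max : ∀ {m} → (∀ c d → V c d ≤ m) → Σ₂ n V ≤ ℤ.+ 2 / 1 →
      4ℚ * gradient V x y ≤ m
    four-gradient≤max {m} V≤m total = begin
      4ℚ * gradient V x y         ≤⟨ *-monoˡ (nonNegative⁻¹ 4ℚ) (gradient≤max*degrees V≤m) ⟩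
      4ℚ * (m * (deg-y * deg-x))  ≡⟨ swap 4ℚ m (deg-y * deg-x) ⟩
      m * (4ℚ * (deg-y * deg-x))  ≤⟨ *-monoˡ 0≤m (four-products≤square deg-x deg-y) ⟩
      m * (s * s)                 ≤⟨ *-monoˡ 0≤m (*-mono (nonNegative⁻¹ 1ℚ) 0≤s (degrees≤1 total) (degrees≤1 total)) ⟩
      m * 1ℚ                      ≡⟨ *-identityʳ m ⟩
      m                           ∎
      where
      open ≤-Reasoning
      s : ℚ
      s = deg-x + deg-y
      0≤s : 0ℚ ≤ s
      0≤s = +-nonNeg deg-x≥0 deg-y≥0
      0≤m : 0ℚ ≤ m
      0≤m = ≤-trans (0≤weight x x) (V≤m x x)
      swap : ∀ i j k → i * (j * k) ≡ j * (i * k)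
      swap = solve-∀ ℚ-ring

  -- Moving weight between edges

  module _ {n : ℕ} where

    private variable V W : Mass n

    cycles≤ : IsWeight V → ∀ {q} → (∀ a b → a ≢ b → gradient V a b ≤ q) → cycles V ≤ q * Σ₂ n V
    cycles≤ {V} wt {q} grad≤q = ≤-trans (Σ₂-mono pointwise) (≤-reflexive (Σ₂-*ˡ q V))
      where
      open IsWeight wt
      pointwise : ∀ a b → V a b * gradient V a b ≤ q * V a b
      pointwise a b with a ≟F b
      ... | yes refl = ≤-reflexive (trans
        (trans (cong (_* gradient V a a) (loopless a)) (*-zeroˡ (gradient V a a)))
        (sym (trans (cong (q *_) (loopless a)) (*-zeroʳ q))))
      ... | no a≢b = subst (V a b * gradient V a b ≤_) (*-comm (V a b) q)
        (*-monoˡ (0≤weight a b) (grad≤q a b a≢b))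

    module _ {x y : Fin n} (x≢y : x ≢ y) where

      edge≥0 : ∀ a b → 0ℚ ≤ edge x≢y a b
      edge≥0 a b with edge-cases x≢y a b
      ... | inj₁ e≡0       = ≤-reflexive (sym e≡0)
      ... | inj₂ (e≡1 , _) = ≤-trans (nonNegative⁻¹ 1ℚ) (≤-reflexive (sym e≡1))

      edge-self : edge x≢y x y ≡ 1ℚ
      edge-self with edge-cases x≢y x y
      ... | inj₂ (e≡1 , _) = e≡1
      ... | inj₁ e≡0 = trans (cong₂ _+_ (cong₂ _*_ (eq-refl x) (eq-refl y))
                                        (trans (cong (_* eq y x) (eq-≢ x≢y)) (*-zeroˡ (eq y x))))
                             refl

      add-edge : Mass n → ℚ → Mass n
      add-edge V δ a b = V a b + δ * edge x≢y a b

      total-add-edge : ∀ V δ → Σ₂ n (add-edge V δ) ≡ Σ₂ n V + (δ + δ)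
      total-add-edge V δ = trans (Σ₂-+ V (λ a b → δ * edge x≢y a b)) (cong (Σ₂ n V +_) (begin
        Σ₂ n (λ a b → δ * edge x≢y a b)  ≡⟨ Σ₂-cong (λ a b → *-comm δ (edge x≢y a b)) ⟩
        Σ₂ n (λ a b → edge x≢y a b * δ)  ≡⟨ Σ₂-edge x≢y (λ _ _ → δ) ⟩
        δ + δ                            ∎))
        where open ≡-Reasoning

      add-edge-isWeight : ∀ {δ} → IsWeight V → (∀ a b → 0ℚ ≤ add-edge V δ a b) → IsWeight (add-edge V δ)
      add-edge-isWeight {V} {δ} wt nonneg = record
        { symmetric = λ a b → cong₂ (λ v e → v + δ * e) (symmetric a b) (edge-sym x≢y a b)
        ; loopless  = λ a → trans
            (cong₂ (λ v e → v + δ * e) (loopless a) (edge-loopless x≢y a))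
            (trans (+-identityˡ (δ * 0ℚ)) (*-zeroʳ δ))
        ; 0≤weight  = nonneg
        }
        where
        open IsWeight wt

    -- Any explicit ceiling would do; it limits the number of moves.
    cycles≤1 : IsWeight W → Σ₂ n W ≡ 2ℚ → cycles W ≤ 1ℚ
    cycles≤1 {W} wt total = begin
      cycles W     ≤⟨ cycles≤ wt (λ a b a≢b → *-cancelˡ-≤-pos 4ℚ
                        (four-gradient≤max wt a≢b W≤2 (≤-reflexive total))) ⟩
      ½ * Σ₂ n W   ≡⟨ cong (½ *_) total ⟩
      1ℚ           ∎
      where
      open ≤-Reasoning
      open IsWeight wt
      W≤2 : ∀ a b → W a b ≤ 2ℚ
      W≤2 a b = ≤-trans (term≤ΣF (0≤weight a) b)
        (≤-trans (term≤ΣF (λ i → ΣF-nonNeg (0≤weight i)) a) (≤-reflexive total))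

  -- One step of the ascent

  module _ {n : ℕ} {W : Mass (suc n)} (wt : IsWeight W) (total : Σ₂ (suc n) W ≡ 2ℚ)
           {δ : ℚ} (0<δ : 0ℚ < δ) (δ≤1/16 : δ ≤ ℤ.+ 1 / 16) where
    open IsWeight wt

    private
      0≤δ : 0ℚ ≤ δ
      0≤δ = <⇒≤ 0<δ

      row-max : (a : Fin (suc n)) → ∃ λ b → ∀ c → W a c ≤ W a b
      row-max a = argmax (W a)

      heaviest-row : ∃ λ a → ∀ c → W c (proj₁ (row-max c)) ≤ W a (proj₁ (row-max a))
      heaviest-row = argmax (λ a → W a (proj₁ (row-max a)))

      x y : Fin (suc n)
      x = proj₁ heaviest-row
      y = proj₁ (row-max x)

      W≤Wxy : ∀ a b → W a b ≤ W x y
      W≤Wxy a b = ≤-trans (proj₂ (row-max a) b) (proj₂ heaviest-row a)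

      slack : ℚ → ℚ
      slack q = ℤ.+ 1 / 32 + ℤ.+ 3 / 1 * q

      1/32≤slack : ℤ.+ 1 / 32 ≤ slack δ
      1/32≤slack = ≤-by-slack (ℤ.+ 3 / 1 * δ) (*-nonNeg (nonNegative⁻¹ (ℤ.+ 3 / 1)) 0≤δ) refl

    Improvement : Set
    Improvement = ∃ λ W′ → IsWeight W′ × Σ₂ (suc n) W′ ≡ 2ℚ × cycles W + 8ℚ * (δ * δ) ≤ cycles W′

    improve : cycles W ≤ ℤ.+ 1 / 32 + ℤ.+ 3 / 1 * δ ⊎ Improvement
    -- Up to 1/16 = 4 · 1/64 the crude bound m / 4 already keeps every derivative below 1/64; from
    -- there on, the heaviest edge can give up δ.
    improve with ≤-total (W x y) (ℤ.+ 1 / 16)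
    ... | inj₁ small = inj₁ (begin
      cycles W               ≤⟨ cycles≤ wt (λ a b a≢b → *-cancelˡ-≤-pos 4ℚ (≤-trans
                                  (four-gradient≤max wt a≢b W≤Wxy (≤-reflexive total)) small)) ⟩
      1/64ℚ * Σ₂ (suc n) W   ≡⟨ cong (1/64ℚ *_) total ⟩
      ℤ.+ 1 / 32             ≤⟨ 1/32≤slack ⟩
      slack δ                ∎)
      where open ≤-Reasoning
    ... | inj₂ 1/16≤Wxy = by-steepest (any? λ c → any? λ d → ¬? (c ≟F d) ×-dec (g + δ <? gradient V c d))
      where
      x≢y : x ≢ y
      x≢y x≡y = <-irrefl refl (<-≤-trans (positive⁻¹ (ℤ.+ 1 / 16))
        (≤-trans 1/16≤Wxy (≤-reflexive (trans (cong (W x) (sym x≡y)) (loopless x)))))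

      -- All derivatives are compared at `V`, so that both `cycles W` and `cycles W′` are exact
      -- shifts of `cycles V`.
      V : Mass (suc n)
      V = add-edge x≢y W (- δ)

      g : ℚ
      g = gradient V x y

      V≥0 : ∀ a b → 0ℚ ≤ V a b
      V≥0 a b with edge-cases x≢y a b
      ... | inj₁ e≡0 = subst (0ℚ ≤_)
        (sym (trans (cong (λ e → W a b + - δ * e) e≡0) (zero-edge (W a b) δ))) (0≤weight a b)
        where
        zero-edge : ∀ w d → w + - d * 0ℚ ≡ w
        zero-edge = solve-∀ ℚ-ring
      ... | inj₂ (e≡1 , at-xy) = subst (0ℚ ≤_)
        (sym (cong₂ (λ v e → v + e) (W≡ at-xy) (trans (cong (- δ *_) e≡1) (*-identityʳ (- δ)))))
        (sub-nonNeg (≤-trans δ≤1/16 1/16≤Wxy))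
        where
        W≡ : (a ≡ x × b ≡ y) ⊎ (a ≡ y × b ≡ x) → W a b ≡ W x y
        W≡ (inj₁ (a≡x , b≡y)) = cong₂ W a≡x b≡y
        W≡ (inj₂ (a≡y , b≡x)) = trans (cong₂ W a≡y b≡x) (symmetric y x)

      V-isWeight : IsWeight V
      V-isWeight = add-edge-isWeight x≢y {V = W} {δ = - δ} wt V≥0

      W≡V+edge : ∀ a b → W a b ≡ V a b + δ * edge x≢y a b
      W≡V+edge a b = restore (W a b) δ (edge x≢y a b)
        where
        restore : ∀ w d e → w ≡ (w + - d * e) + d * e
        restore = solve-∀ ℚ-ring

      cyclesW : cycles W ≡ cycles V + 8ℚ * δ * g
      cyclesW = cycles-shift x≢y V-isWeight δ W≡V+edge

      totalV : Σ₂ (suc n) V ≡ 2ℚ + (- δ + - δ)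
      totalV = trans (total-add-edge x≢y W (- δ)) (cong (_+ (- δ + - δ)) total)

      V≤Wxy : ∀ a b → V a b ≤ W x y
      V≤Wxy a b = ≤-trans
        (≤-by-slack (δ * edge x≢y a b) (*-nonNeg 0≤δ (edge≥0 x≢y a b)) (sym (W≡V+edge a b)))
        (W≤Wxy a b)

      g≤1/64 : g ≤ 1/64ℚ
      g≤1/64 = gradient≤1/64 V-isWeight x≢y V≤Wxy (begin
        Σ₂ (suc n) V + (W x y + W x y)
          ≡⟨ cong (_+ (W x y + W x y)) totalV ⟩
        2ℚ + (- δ + - δ) + (W x y + W x y)
          ≡⟨ regroup 2ℚ δ (W x y) ⟩
        2ℚ + ((W x y + - δ * 1ℚ) + (W x y + - δ * 1ℚ))
          ≡⟨ cong (λ e → 2ℚ + ((W x y + - δ * e) + (W x y + - δ * e))) (sym (edge-self x≢y)) ⟩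
        2ℚ + (V x y + V x y) ∎)
        where
        open ≡-Reasoning
        regroup : ∀ k d w → k + (- d + - d) + (w + w) ≡ k + ((w + - d * 1ℚ) + (w + - d * 1ℚ))
        regroup = solve-∀ ℚ-ring

      by-steepest : Dec (∃ λ c → ∃ λ d → c ≢ d × g + δ < gradient V c d) →
        cycles W ≤ slack δ ⊎ Improvement
      by-steepest (yes (c , d , c≢d , steeper)) =
        inj₂ (W′ , W′-isWeight , totalW′ , (begin
          cycles W + 8ℚ * (δ * δ)
            ≡⟨ cong (_+ 8ℚ * (δ * δ)) cyclesW ⟩
          cycles V + 8ℚ * δ * g + 8ℚ * (δ * δ)
            ≡⟨ collect 8ℚ (cycles V) δ g ⟩
          cycles V + 8ℚ * δ * (g + δ)
            ≤⟨ +-monoʳ-≤ (cycles V) (*-monoˡ (*-nonNeg (nonNegative⁻¹ 8ℚ) 0≤δ) (<⇒≤ steeper)) ⟩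
          cycles V + 8ℚ * δ * gradient V c d
            ≡⟨ sym (cycles-shift c≢d V-isWeight δ (λ a b → refl)) ⟩
          cycles W′ ∎))
        where
        open ≤-Reasoning
        W′ : Mass (suc n)
        W′ = add-edge c≢d V δ
        W′-isWeight : IsWeight W′
        W′-isWeight = add-edge-isWeight c≢d {V = V} {δ = δ} V-isWeight
          (λ a b → +-nonNeg (V≥0 a b) (*-nonNeg 0≤δ (edge≥0 c≢d a b)))
        cancel : ∀ k d → k + (- d + - d) + (d + d) ≡ k
        cancel = solve-∀ ℚ-ring
        totalW′ : Σ₂ (suc n) W′ ≡ 2ℚ
        totalW′ = trans (total-add-edge c≢d V δ) (trans (cong (_+ (δ + δ)) totalV) (cancel 2ℚ δ))
        collect : ∀ k h d g → h + k * d * g + k * (d * d) ≡ h + k * d * (g + d)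
        collect = solve-∀ ℚ-ring
      -- No derivative at `V` exceeds 1/64 + δ, so Euler's identity bounds `cycles V`; returning δ
      -- to xy costs at most 8 δ / 64. The error 2 δ + δ / 8 is rounded up to 3 δ.
      by-steepest (no none) = inj₁ (begin
        cycles W
          ≡⟨ cyclesW ⟩
        cycles V + 8ℚ * δ * g
          ≤⟨ +-mono-≤ (cycles≤ V-isWeight flat) (*-monoˡ (*-nonNeg (nonNegative⁻¹ 8ℚ) 0≤δ) g≤1/64) ⟩
        (1/64ℚ + δ) * Σ₂ (suc n) V + 8ℚ * δ * 1/64ℚ
          ≤⟨ +-monoˡ-≤ (8ℚ * δ * 1/64ℚ) (*-monoˡ (+-nonNeg (nonNegative⁻¹ 1/64ℚ) 0≤δ) totalV≤2) ⟩
        (1/64ℚ + δ) * 2ℚ + 8ℚ * δ * 1/64ℚ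
          ≤⟨ ≤-by-slack (ℤ.+ 7 / 8 * δ) (*-nonNeg (nonNegative⁻¹ (ℤ.+ 7 / 8)) 0≤δ) (estimate δ) ⟩
        slack δ ∎)
        where
        open ≤-Reasoning
        flat : ∀ a b → a ≢ b → gradient V a b ≤ 1/64ℚ + δ
        flat a b a≢b = ≤-trans (≮⇒≥ (λ lt → none (a , b , a≢b , lt))) (+-monoˡ-≤ δ g≤1/64)
        drop : ∀ k d → k + (- d + - d) + (d + d) ≡ k
        drop = solve-∀ ℚ-ring
        totalV≤2 : Σ₂ (suc n) V ≤ 2ℚ
        totalV≤2 = ≤-by-slack (δ + δ) (+-nonNeg 0≤δ 0≤δ)
          (trans (cong (_+ (δ + δ)) totalV) (drop 2ℚ δ))
        estimate : ∀ d → (1/64ℚ + d) * 2ℚ + 8ℚ * d * 1/64ℚ + ℤ.+ 7 / 8 * d ≡ ℤ.+ 1 / 32 + ℤ.+ 3 / 1 * d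
        estimate = solve-∀ ℚ-ring

  -- Termination of the ascent and the limit δ → 0

  cycles≤slack⊎fuel : ∀ {n} {δ} → 0ℚ < δ → δ ≤ ℤ.+ 1 / 16 → ∀ k {W : Mass (suc n)} →
    IsWeight W → Σ₂ (suc n) W ≡ 2ℚ →
    cycles W ≤ ℤ.+ 1 / 32 + ℤ.+ 3 / 1 * δ ⊎ cycles W + fromℕ k * (8ℚ * (δ * δ)) ≤ 1ℚ
  cycles≤slack⊎fuel {δ = δ} 0<δ δ≤ zero {W} wt total = inj₂ (subst (_≤ 1ℚ)
    (sym (trans (cong (cycles W +_) (*-zeroˡ (8ℚ * (δ * δ)))) (+-identityʳ (cycles W))))
    (cycles≤1 wt total))
  cycles≤slack⊎fuel {δ = δ} 0<δ δ≤ (suc k) {W} wt total with improve wt total 0<δ δ≤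
  ... | inj₁ done = inj₁ done
  ... | inj₂ (W′ , wt′ , total′ , better) with cycles≤slack⊎fuel 0<δ δ≤ k wt′ total′
  ...   | inj₁ done = inj₁ (≤-trans (≤-by-slack c 0≤c refl) (≤-trans better done))
    where
    c : ℚ
    c = 8ℚ * (δ * δ)
    0≤c : 0ℚ ≤ c
    0≤c = *-nonNeg (nonNegative⁻¹ 8ℚ) (square-nonNeg δ)
  ...   | inj₂ fuel = inj₂ (begin
    cycles W + fromℕ (suc k) * c       ≡⟨ cong (λ l → cycles W + l * c) (fromℕ-suc k) ⟩
    cycles W + (1ℚ + fromℕ k) * c      ≡⟨ unroll (cycles W) (fromℕ k) c ⟩
    cycles W + c + fromℕ k * c         ≤⟨ +-monoˡ-≤ (fromℕ k * c) better ⟩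
    cycles W′ + fromℕ k * c            ≤⟨ fuel ⟩
    1ℚ                                 ∎)
    where
    open ≤-Reasoning
    c : ℚ
    c = 8ℚ * (δ * δ)
    unroll : ∀ h l c → h + (1ℚ + l) * c ≡ h + c + l * c
    unroll = solve-∀ ℚ-ring

  cycles≤slack : ∀ {n} {δ} → 0ℚ < δ → δ ≤ ℤ.+ 1 / 16 → {W : Mass (suc n)} →
    IsWeight W → Σ₂ (suc n) W ≡ 2ℚ → cycles W ≤ ℤ.+ 1 / 32 + ℤ.+ 3 / 1 * δ
  cycles≤slack {δ = δ} 0<δ δ≤ {W} wt total = by-fuel (archimedean c 0<c)
    where
    instance
      δ-positive : Positive δ
      δ-positive = positive 0<δ

    c : ℚ
    c = 8ℚ * (δ * δ)

    0<c : 0ℚ < c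
    0<c = positive⁻¹ c {{pos*pos⇒pos 8ℚ (δ * δ) {{pos*pos⇒pos δ δ}}}}

    cancel : ∀ h → h + 1ℚ + - 1ℚ ≡ h
    cancel = solve-∀ ℚ-ring

    by-fuel : (∃ λ k → 1ℚ ≤ fromℕ k * c) → cycles W ≤ ℤ.+ 1 / 32 + ℤ.+ 3 / 1 * δ
    by-fuel (k , 1≤kc) with cycles≤slack⊎fuel 0<δ δ≤ k wt total
    ... | inj₁ done = done
    -- Here k gains of `c` add up to at least 1, the ceiling, which leaves `cycles W ≤ 0`.
    ... | inj₂ fuel = ≤-trans
      (subst (_≤ 0ℚ) (cancel (cycles W))
        (+-monoˡ-≤ (- 1ℚ) (≤-trans (+-monoʳ-≤ (cycles W) 1≤kc) fuel)))
      (+-nonNeg (nonNegative⁻¹ (ℤ.+ 1 / 32)) (*-nonNeg (nonNegative⁻¹ (ℤ.+ 3 / 1)) (<⇒≤ 0<δ)))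

  -- A positive excess e would satisfy e ≤ 3 δ for δ = min (e / 4 , 1/16), hence e ≤ 3 e / 4.
  cycles≤1/32 : ∀ {n} {W : Mass n} → IsWeight W → Σ₂ n W ≡ 2ℚ → cycles W ≤ ℤ.+ 1 / 32
  cycles≤1/32 {zero}  wt total = nonNegative⁻¹ (ℤ.+ 1 / 32)
  cycles≤1/32 {suc n} {W} wt total = ≮⇒≥ λ gap → <-irrefl refl (<-≤-trans (0<¼e gap) (¼e≤0 gap))
    where
    e ¼e : ℚ
    e  = cycles W + - (ℤ.+ 1 / 32)
    ¼e = ℤ.+ 1 / 4 * e

    0<¼e : ℤ.+ 1 / 32 < cycles W → 0ℚ < ¼e
    0<¼e gap = positive⁻¹ ¼e
      {{pos*pos⇒pos (ℤ.+ 1 / 4) e {{positive (+-monoˡ-< (- (ℤ.+ 1 / 32)) gap)}}}}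

    ¼e≤0-from : ∀ {δ} → 0ℚ < δ → δ ≤ ℤ.+ 1 / 16 → δ ≤ ¼e → ¼e ≤ 0ℚ
    ¼e≤0-from {δ} 0<δ δ≤1/16 δ≤¼e = begin
      ¼e ≡⟨ split (cycles W) ⟩
      cycles W + - (ℤ.+ 1 / 32 + ℤ.+ 3 / 1 * ¼e)
        ≤⟨ +-monoˡ-≤ (- (ℤ.+ 1 / 32 + ℤ.+ 3 / 1 * ¼e)) (≤-trans
             (cycles≤slack 0<δ δ≤1/16 wt total)
             (+-monoʳ-≤ (ℤ.+ 1 / 32) (*-monoˡ (nonNegative⁻¹ (ℤ.+ 3 / 1)) δ≤¼e))) ⟩
      (ℤ.+ 1 / 32 + ℤ.+ 3 / 1 * ¼e) + - (ℤ.+ 1 / 32 + ℤ.+ 3 / 1 * ¼e)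
        ≡⟨ +-inverseʳ (ℤ.+ 1 / 32 + ℤ.+ 3 / 1 * ¼e) ⟩
      0ℚ ∎
      where
      open ≤-Reasoning
      split : ∀ h → ℤ.+ 1 / 4 * (h + - (ℤ.+ 1 / 32)) ≡
        h + - (ℤ.+ 1 / 32 + ℤ.+ 3 / 1 * (ℤ.+ 1 / 4 * (h + - (ℤ.+ 1 / 32))))
      split = solve-∀ ℚ-ring

    ¼e≤0 : ℤ.+ 1 / 32 < cycles W → ¼e ≤ 0ℚ
    ¼e≤0 gap with ≤-total ¼e (ℤ.+ 1 / 16)
    ... | inj₁ small = ¼e≤0-from (0<¼e gap) small ≤-refl
    ... | inj₂ large = ¼e≤0-from (positive⁻¹ (ℤ.+ 1 / 16)) ≤-refl large

  -- Enumeration of the 4-cycles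

  lt : ∀ {n} → Fin n → Fin n → ℚ
  lt i j with i <?F j
  ... | yes _ = 1ℚ
  ... | no  _ = 0ℚ

  module _ {n : ℕ} where

    private
      -- The summand is local to ΣPairs; unification recovers it.
      pairs-summand : (f : Fin n → Fin n → ℚ) → Σ (Fin n → Fin n → ℚ) λ h → ΣPairs n f ≡ Σ₂ n h
      pairs-summand f = _ , refl

      pairs-summand≡ : ∀ f i j → proj₁ (pairs-summand f) i j ≡ lt i j * f i j
      pairs-summand≡ f i j with i <?F j
      ... | yes _ = sym (*-identityˡ (f i j))
      ... | no  _ = sym (*-zeroˡ (f i j))

    ΣPairs≡Σ₂ : ∀ f → ΣPairs n f ≡ Σ₂ n (λ i j → lt i j * f i j)
    ΣPairs≡Σ₂ f = Σ₂-cong (pairs-summand≡ f)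

    private
      quad-summand : (f : Fin n → Fin n → Fin n → Fin n → ℚ) →
        Σ (Fin n → Fin n → Fin n → Fin n → ℚ) λ h →
          ΣQuad n f ≡ ΣPairs n (λ a b → ΣPairs n (λ c d → h a b c d))
      quad-summand f = _ , refl

      quad-summand≡ : ∀ f a b c d → proj₁ (quad-summand f) a b c d ≡ lt b c * f a b c d
      quad-summand≡ f a b c d with b <?F c
      ... | yes _ = sym (*-identityˡ (f a b c d))
      ... | no  _ = sym (*-zeroˡ (f a b c d))

    -- The indicator of a < b < c < d, with its factors in the order in which `ΣQuad` tests them.
    sorted : Fin n → Fin n → Fin n → Fin n → ℚ
    sorted a b c d = lt a b * (lt c d * lt b c)

    ΣQuad≡Σ₄ : ∀ f → ΣQuad n f ≡ Σ₄ n (λ a b c d → sorted a b c d * f a b c d)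
    ΣQuad≡Σ₄ f = trans
      (ΣPairs≡Σ₂ (λ a b → ΣPairs n (λ c d → proj₁ (quad-summand f) a b c d)))
      (Σ₂-cong λ a b → trans
        (cong (lt a b *_) (ΣPairs≡Σ₂ (λ c d → proj₁ (quad-summand f) a b c d)))
        (trans (sym (Σ₂-*ˡ (lt a b) (λ c d → lt c d * proj₁ (quad-summand f) a b c d)))
          (Σ₂-cong λ c d → trans
            (cong (λ q → lt a b * (lt c d * q)) (quad-summand≡ f a b c d))
            (regroup (lt a b) (lt c d) (lt b c) (f a b c d)))))
      where
      regroup : ∀ p q r v → p * (q * (r * v)) ≡ p * (q * r) * v
      regroup = solve-∀ ℚ-ring

  module _ {n : ℕ} where

    lt-yes : ∀ {i j : Fin n} → i <F j → lt i j ≡ 1ℚ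
    lt-yes {i} {j} i<j with i <?F j
    ... | yes _   = refl
    ... | no  i≮j = ⊥-elim (i≮j i<j)

    lt-no : ∀ {i j : Fin n} → ¬ i <F j → lt i j ≡ 0ℚ
    lt-no {i} {j} i≮j with i <?F j
    ... | yes i<j = ⊥-elim (i≮j i<j)
    ... | no  _   = refl

    lt-cases : ∀ (i j : Fin n) → (lt i j ≡ 0ℚ) ⊎ (lt i j ≡ 1ℚ × i <F j)
    lt-cases i j with i <?F j
    ... | yes i<j = inj₂ (refl , i<j)
    ... | no  _   = inj₁ refl

    lt-nonNeg : ∀ (i j : Fin n) → 0ℚ ≤ lt i j
    lt-nonNeg i j with i <?F j
    ... | yes _ = nonNegative⁻¹ 1ℚ
    ... | no  _ = ≤-refl

    lt+lt≡ne : ∀ (i j : Fin n) → lt i j + lt j i ≡ ne i j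
    lt+lt≡ne i j with <F-cmp i j
    ... | tri< i<j i≢j j≮i = trans (cong₂ _+_ (lt-yes i<j) (lt-no j≮i)) (sym (ne-≢ i≢j))
    ... | tri≈ i≮j refl j≮i = trans (cong₂ _+_ (lt-no i≮j) (lt-no j≮i)) (sym (ne-refl i))
    ... | tri> i≮j i≢j j<i = trans (cong₂ _+_ (lt-no i≮j) (lt-yes j<i)) (sym (ne-≢ i≢j))

    private
      product-cases : ∀ {P Q : Set} {p q : ℚ} → (p ≡ 0ℚ) ⊎ (p ≡ 1ℚ × P) → (q ≡ 0ℚ) ⊎ (q ≡ 1ℚ × Q) →
        (p * q ≡ 0ℚ) ⊎ (p * q ≡ 1ℚ × P × Q)
      product-cases {q = q} (inj₁ refl) _ = inj₁ (*-zeroˡ q)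
      product-cases {p = p} (inj₂ _) (inj₁ refl) = inj₁ (*-zeroʳ p)
      product-cases (inj₂ (refl , P)) (inj₂ (refl , Q)) = inj₂ (refl , P , Q)

    sorted-cases : ∀ (a b c d : Fin n) →
      (sorted a b c d ≡ 0ℚ) ⊎ (sorted a b c d ≡ 1ℚ × a <F b × c <F d × b <F c)
    sorted-cases a b c d =
      product-cases (lt-cases a b) (product-cases (lt-cases c d) (lt-cases b c))

    first-least : Fin n → Fin n → Fin n → Fin n → ℚ
    first-least a b c d = lt a b * (lt a c * lt a d)

    first-least-cases : ∀ (a b c d : Fin n) →
      (first-least a b c d ≡ 0ℚ) ⊎ (first-least a b c d ≡ 1ℚ × a <F b × a <F c × a <F d)
    first-least-cases a b c d =
      product-cases (lt-cases a b) (product-cases (lt-cases a c) (lt-cases a d))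

    first-least-nonNeg : ∀ (a b c d : Fin n) → 0ℚ ≤ first-least a b c d
    first-least-nonNeg a b c d =
      *-nonNeg (lt-nonNeg a b) (*-nonNeg (lt-nonNeg a c) (lt-nonNeg a d))

    private
      <F-contra : ∀ {i : Fin n} {A : Set} → i <F i → A
      <F-contra i<i = ⊥-elim (<F-irrefl refl i<i)

      infixr 5 _∙_
      _∙_ : ∀ {i j k : Fin n} → i <F j → j <F k → i <F k
      _∙_ = <F-trans

      three≤ : ∀ {p q r p′ q′ r′ b} → p ≡ p′ → q ≡ q′ → r ≡ r′ → p′ + (q′ + r′) ≤ b → p + (q + r) ≤ b
      three≤ refl refl refl le = le

      four≤ : ∀ {p q r s p′ q′ r′ s′ b} → p ≡ p′ → q ≡ q′ → r ≡ r′ → s ≡ s′ →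
        p′ + (q′ + (r′ + s′)) ≤ b → p + (q + (r + s)) ≤ b
      four≤ refl refl refl refl le = le

    -- Normal form of a 4-cycle: start at the least vertex and go first to its smaller neighbour.
    normal-form : Fin n → Fin n → Fin n → Fin n → ℚ
    normal-form a b c d = sorted a b c d + (sorted a b d c + sorted a c b d)

    -- The orders a < b < c < d, a < b < d < c and a < c < b < d exclude one another, and in each of
    -- them a is least and b < d.
    normal-form≤ : ∀ a b c d → normal-form a b c d ≤ first-least a b c d * lt b d
    normal-form≤ a b c d with sorted-cases a b c d | sorted-cases a b d c | sorted-cases a c b d
    ... | inj₁ p | inj₁ q | inj₁ r =
      three≤ p q r (*-nonNeg (first-least-nonNeg a b c d) (lt-nonNeg b d))
    ... | inj₂ (_ , _ , c<d , _) | inj₂ (_ , _ , d<c , _) | _ = <F-contra (c<d ∙ d<c)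
    ... | inj₂ (_ , _ , _ , b<c) | _ | inj₂ (_ , _ , _ , c<b) = <F-contra (b<c ∙ c<b)
    ... | _ | inj₂ (_ , _ , d<c , b<d) | inj₂ (_ , _ , _ , c<b) = <F-contra (b<d ∙ d<c ∙ c<b)
    ... | inj₂ (p , a<b , c<d , b<c) | inj₁ q | inj₁ r = three≤ p q r (≤-reflexive (sym
      (cong₂ _*_ (cong₂ _*_ (lt-yes a<b) (cong₂ _*_ (lt-yes (a<b ∙ b<c)) (lt-yes (a<b ∙ b<c ∙ c<d))))
                 (lt-yes (b<c ∙ c<d)))))
    ... | inj₁ p | inj₂ (q , a<b , d<c , b<d) | inj₁ r = three≤ p q r (≤-reflexive (sym
      (cong₂ _*_ (cong₂ _*_ (lt-yes a<b) (cong₂ _*_ (lt-yes (a<b ∙ b<d ∙ d<c)) (lt-yes (a<b ∙ b<d))))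
                 (lt-yes b<d))))
    ... | inj₁ p | inj₁ q | inj₂ (r , a<c , b<d , c<b) = three≤ p q r (≤-reflexive (sym
      (cong₂ _*_ (cong₂ _*_ (lt-yes (a<c ∙ c<b)) (cong₂ _*_ (lt-yes a<c) (lt-yes (a<c ∙ c<b ∙ b<d))))
                 (lt-yes b<d))))

    first-least-rotations≤1 : ∀ a b c d →
      first-least a b c d + (first-least b c d a + (first-least c d a b + first-least d a b c)) ≤ 1ℚ
    first-least-rotations≤1 a b c d
      with first-least-cases a b c d | first-least-cases b c d a
         | first-least-cases c d a b | first-least-cases d a b c
    ... | inj₂ (_ , a<b , _ , _) | inj₂ (_ , _ , _ , b<a) | _ | _ = <F-contra (a<b ∙ b<a)
    ... | inj₂ (_ , _ , a<c , _) | _ | inj₂ (_ , _ , c<a , _) | _ = <F-contra (a<c ∙ c<a)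
    ... | inj₂ (_ , _ , _ , a<d) | _ | _ | inj₂ (_ , d<a , _ , _) = <F-contra (a<d ∙ d<a)
    ... | _ | inj₂ (_ , b<c , _ , _) | inj₂ (_ , _ , _ , c<b) | _ = <F-contra (b<c ∙ c<b)
    ... | _ | inj₂ (_ , _ , b<d , _) | _ | inj₂ (_ , _ , d<b , _) = <F-contra (b<d ∙ d<b)
    ... | _ | _ | inj₂ (_ , c<d , _ , _) | inj₂ (_ , _ , _ , d<c) = <F-contra (c<d ∙ d<c)
    ... | inj₁ p | inj₁ q | inj₁ r | inj₁ s = four≤ p q r s (nonNegative⁻¹ 1ℚ)
    ... | inj₂ (p , _) | inj₁ q | inj₁ r | inj₁ s = four≤ p q r s ≤-refl
    ... | inj₁ p | inj₂ (q , _) | inj₁ r | inj₁ s = four≤ p q r s ≤-refl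
    ... | inj₁ p | inj₁ q | inj₂ (r , _) | inj₁ s = four≤ p q r s ≤-refl
    ... | inj₁ p | inj₁ q | inj₁ r | inj₂ (s , _) = four≤ p q r s ≤-refl

    Σ₄-reflect : (f : Fin n → Fin n → Fin n → Fin n → ℚ) →
      Σ₄ n (λ a b c d → f a d c b) ≡ Σ₄ n f
    Σ₄-reflect f = ΣF-cong λ a → trans
      (ΣF-swap (λ b c → ΣF n (λ d → f a d c b)))
      (trans (ΣF-cong λ c → ΣF-swap (λ b d → f a d c b))
             (ΣF-swap (λ c d → ΣF n (λ b → f a d c b))))

    term≤Σ₄ : {f : Fin n → Fin n → Fin n → Fin n → ℚ} → (∀ a b c d → 0ℚ ≤ f a b c d) →
      ∀ a b c d → f a b c d ≤ Σ₄ n f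
    term≤Σ₄ {f} 0≤f a b c d =
      ≤-trans (term≤ΣF (0≤f a b c) d) (
      ≤-trans (term≤ΣF (λ c → ΣF-nonNeg (0≤f a b c)) c) (
      ≤-trans (term≤ΣF (λ b → Σ₂-nonNeg (0≤f a b)) b)
              (term≤ΣF (λ a → ΣF-nonNeg λ b → Σ₂-nonNeg (0≤f a b)) a)))

    -- Each 4-cycle occurs eight times among the ordered quadruples

    module CycleCount {W : Mass n} (wt : IsWeight W) where
      open IsWeight wt

      cycle : Fin n → Fin n → Fin n → Fin n → ℚ
      cycle a b c d = W a b * (W b c * (W c d * W d a))

      cycle-nonNeg : ∀ a b c d → 0ℚ ≤ cycle a b c d
      cycle-nonNeg a b c d = *-nonNeg (0≤weight a b)
        (*-nonNeg (0≤weight b c) (*-nonNeg (0≤weight c d) (0≤weight d a)))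

      sorted-cycles : Fin n → Fin n → Fin n → Fin n → ℚ
      sorted-cycles a b c d = sorted a b c d * (cycle a b c d + (cycle a b d c + cycle a c b d))

      count : ℚ
      count = Σ₄ n sorted-cycles

      -- Exchanging c and d in the second term and b and c in the third turns three cycles on one
      -- sorted quadruple into one cycle on three orders of its vertices.
      count≡normal-form : count ≡ Σ₄ n (λ a b c d → normal-form a b c d * cycle a b c d)
      count≡normal-form = begin
        Σ₄ n (λ a b c d → sorted a b c d * (cycle a b c d + (cycle a b d c + cycle a c b d)))
          ≡⟨ Σ₄-cong (λ a b c d → distribute (sorted a b c d) (cycle a b c d) (cycle a b d c) (cycle a c b d)) ⟩
        Σ₄ n (λ a b c d → sorted a b c d * cycle a b c d
                          + (sorted a b c d * cycle a b d c + sorted a b c d * cycle a c b d))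
          ≡⟨ Σ₄-+ (λ a b c d → sorted a b c d * cycle a b c d)
                  (λ a b c d → sorted a b c d * cycle a b d c + sorted a b c d * cycle a c b d) ⟩
        S + Σ₄ n (λ a b c d → sorted a b c d * cycle a b d c + sorted a b c d * cycle a c b d)
          ≡⟨ cong (S +_) (trans
               (Σ₄-+ (λ a b c d → sorted a b c d * cycle a b d c) (λ a b c d → sorted a b c d * cycle a c b d))
               (cong₂ _+_
                 (Σ₂-cong λ a b → ΣF-swap (λ c d → sorted a b c d * cycle a b d c))
                 (ΣF-cong λ a → ΣF-swap (λ b c → ΣF n (λ d → sorted a b c d * cycle a c b d))))) ⟩
        S + (Σ₄ n (λ a b c d → sorted a b d c * cycle a b c d) + Σ₄ n (λ a b c d → sorted a c b d * cycle a b c d))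
          ≡⟨ cong (S +_) (sym (Σ₄-+ (λ a b c d → sorted a b d c * cycle a b c d)
                                   (λ a b c d → sorted a c b d * cycle a b c d))) ⟩
        S + Σ₄ n (λ a b c d → sorted a b d c * cycle a b c d + sorted a c b d * cycle a b c d)
          ≡⟨ sym (Σ₄-+ (λ a b c d → sorted a b c d * cycle a b c d)
                       (λ a b c d → sorted a b d c * cycle a b c d + sorted a c b d * cycle a b c d)) ⟩
        Σ₄ n (λ a b c d → sorted a b c d * cycle a b c d
                          + (sorted a b d c * cycle a b c d + sorted a c b d * cycle a b c d))
          ≡⟨ Σ₄-cong (λ a b c d → collect (sorted a b c d) (sorted a b d c) (sorted a c b d) (cycle a b c d)) ⟩
        Σ₄ n (λ a b c d → normal-form a b c d * cycle a b c d) ∎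
        where
        open ≡-Reasoning
        S : ℚ
        S = Σ₄ n (λ a b c d → sorted a b c d * cycle a b c d)
        distribute : ∀ s p q r → s * (p + (q + r)) ≡ s * p + (s * q + s * r)
        distribute = solve-∀ ℚ-ring
        collect : ∀ p q r g → p * g + (q * g + r * g) ≡ (p + (q + r)) * g
        collect = solve-∀ ℚ-ring

      cycle-reflect : ∀ a b c d → cycle a d c b ≡ cycle a b c d
      cycle-reflect a b c d = trans
        (cong₂ _*_ (symmetric a d) (cong₂ _*_ (symmetric d c) (cong₂ _*_ (symmetric c b) (symmetric b a))))
        (reverse (W d a) (W c d) (W b c) (W a b))
        where
        reverse : ∀ p q r s → p * (q * (r * s)) ≡ s * (r * (q * p))
        reverse = solve-∀ ℚ-ring

      least-cycle : Fin n → Fin n → Fin n → Fin n → ℚ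
      least-cycle a b c d = first-least a b c d * (ne a c * ne b d * cycle a b c d)

      -- The factor 2 is the direction of traversal: reflection exchanges b and d, and the
      -- conditions b < d and d < b together amount to b ≠ d.
      two-counts≤ : count + count ≤ Σ₄ n least-cycle
      two-counts≤ = begin
        count + count
          ≤⟨ +-mono-≤ count≤ count≤ ⟩
        Σ₄ n h + Σ₄ n h
          ≡⟨ cong (Σ₄ n h +_) (sym (Σ₄-reflect h)) ⟩
        Σ₄ n h + Σ₄ n (λ a b c d → h a d c b)
          ≡⟨ sym (Σ₄-+ h (λ a b c d → h a d c b)) ⟩
        Σ₄ n (λ a b c d → h a b c d + h a d c b)
          ≡⟨ Σ₄-cong pointwise ⟩
        Σ₄ n least-cycle ∎
        where
        open ≤-Reasoning
        h : Fin n → Fin n → Fin n → Fin n → ℚ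
        h a b c d = first-least a b c d * lt b d * cycle a b c d

        count≤ : count ≤ Σ₄ n h
        count≤ = ≤-trans (≤-reflexive count≡normal-form)
          (Σ₄-mono λ a b c d → *-monoʳ (cycle-nonNeg a b c d) (normal-form≤ a b c d))

        factor : ∀ i j k p q g → i * (j * k) * p * g + k * (j * i) * q * g ≡ i * (j * k) * ((p + q) * g)
        factor = solve-∀ ℚ-ring

        regroup : ∀ u p g → u * (p * g) ≡ u * (1ℚ * p * g)
        regroup = solve-∀ ℚ-ring

        insert-ne : ∀ a b c d → first-least a b c d * (ne b d * cycle a b c d) ≡ least-cycle a b c d
        insert-ne a b c d with first-least-cases a b c d
        ... | inj₁ u≡0 = trans (zero-first (ne b d * cycle a b c d))
                               (sym (zero-first (ne a c * ne b d * cycle a b c d)))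
          where
          zero-first : ∀ q → first-least a b c d * q ≡ 0ℚ
          zero-first q = trans (cong (_* q) u≡0) (*-zeroˡ q)
        ... | inj₂ (_ , _ , a<c , _) = trans
          (regroup (first-least a b c d) (ne b d) (cycle a b c d))
          (cong (λ p → first-least a b c d * (p * ne b d * cycle a b c d))
            (sym (ne-≢ {i = a} {c} λ { refl → <F-irrefl refl a<c })))

        pointwise : ∀ a b c d → h a b c d + h a d c b ≡ least-cycle a b c d
        pointwise a b c d = begin-equality
          h a b c d + h a d c b
            ≡⟨ cong (λ g → h a b c d + first-least a d c b * lt d b * g) (cycle-reflect a b c d) ⟩
          h a b c d + first-least a d c b * lt d b * cycle a b c d
            ≡⟨ factor (lt a b) (lt a c) (lt a d) (lt b d) (lt d b) (cycle a b c d) ⟩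
          first-least a b c d * ((lt b d + lt d b) * cycle a b c d)
            ≡⟨ cong (λ p → first-least a b c d * (p * cycle a b c d)) (lt+lt≡ne b d) ⟩
          first-least a b c d * (ne b d * cycle a b c d)
            ≡⟨ insert-ne a b c d ⟩
          least-cycle a b c d ∎

      -- The factor 4 is the starting vertex: after rotation, the four copies ask for different
      -- vertices to be the least, and at most one of these demands holds.
      four-least-cycles≤ :
        Σ₄ n least-cycle + (Σ₄ n least-cycle + (Σ₄ n least-cycle + Σ₄ n least-cycle)) ≤ cycles W
      four-least-cycles≤ = begin
        S + (S + (S + S))
          ≡⟨ cong₂ (λ s₁ s → S + (s₁ + s)) (sym rotate₁) (cong₂ _+_ (sym rotate₂) (sym rotate₃)) ⟩
        S + (Σ₄ n f₁ + (Σ₄ n f₂ + Σ₄ n f₃))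
          ≡⟨ cong (λ s → S + (Σ₄ n f₁ + s)) (sym (Σ₄-+ f₂ f₃)) ⟩
        S + (Σ₄ n f₁ + Σ₄ n (λ a b c d → f₂ a b c d + f₃ a b c d))
          ≡⟨ cong (S +_) (sym (Σ₄-+ f₁ (λ a b c d → f₂ a b c d + f₃ a b c d))) ⟩
        S + Σ₄ n (λ a b c d → f₁ a b c d + (f₂ a b c d + f₃ a b c d))
          ≡⟨ sym (Σ₄-+ least-cycle (λ a b c d → f₁ a b c d + (f₂ a b c d + f₃ a b c d))) ⟩
        Σ₄ n (λ a b c d → least-cycle a b c d + (f₁ a b c d + (f₂ a b c d + f₃ a b c d)))
          ≤⟨ Σ₄-mono pointwise ⟩
        Σ₄ n (λ a b c d → W a b * path W a b c d)
          ≡⟨ sym (pairing-Σ₄ W W) ⟩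
        cycles W ∎
        where
        open ≤-Reasoning
        S : ℚ
        S = Σ₄ n least-cycle

        f₁ f₂ f₃ : Fin n → Fin n → Fin n → Fin n → ℚ
        f₁ a b c d = least-cycle b c d a
        f₂ a b c d = least-cycle c d a b
        f₃ a b c d = least-cycle d a b c

        rotate₁ : Σ₄ n f₁ ≡ S
        rotate₁ = Σ₄-rotate least-cycle

        rotate₂ : Σ₄ n f₂ ≡ S
        rotate₂ = trans (Σ₄-rotate f₁) rotate₁

        rotate₃ : Σ₄ n f₃ ≡ S
        rotate₃ = trans (Σ₄-rotate f₂) rotate₂

        collect : ∀ u₀ u₁ u₂ u₃ i j p q r s →
          u₀ * (i * j * (p * (q * (r * s)))) + (u₁ * (j * i * (q * (r * (s * p))))
            + (u₂ * (i * j * (r * (s * (p * q)))) + u₃ * (j * i * (s * (p * (q * r)))))) ≡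
          (u₀ + (u₁ + (u₂ + u₃))) * (p * (i * j * (q * (r * s))))
        collect = solve-∀ ℚ-ring

        pointwise : ∀ a b c d →
          least-cycle a b c d + (f₁ a b c d + (f₂ a b c d + f₃ a b c d)) ≤ W a b * path W a b c d
        pointwise a b c d
          rewrite ne-sym c a | ne-sym d b = begin
          _ ≡⟨ collect (first-least a b c d) (first-least b c d a) (first-least c d a b) (first-least d a b c)
                 (ne a c) (ne b d) (W a b) (W b c) (W c d) (W d a) ⟩
          (first-least a b c d + (first-least b c d a + (first-least c d a b + first-least d a b c)))
            * (W a b * path W a b c d)
            ≤⟨ *-monoʳ (*-nonNeg (0≤weight a b) (*-nonNeg (*-nonNeg (ne-nonNeg a c) (ne-nonNeg b d))
                 (*-nonNeg (0≤weight b c) (*-nonNeg (0≤weight c d) (0≤weight d a)))))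
                 (first-least-rotations≤1 a b c d) ⟩
          1ℚ * (W a b * path W a b c d) ≡⟨ *-identityˡ (W a b * path W a b c d) ⟩
          W a b * path W a b c d ∎

      count≤1/256 : Σ₂ n W ≡ ℤ.+ 2 / 1 → count ≤ ℤ.+ 1 / 256
      count≤1/256 total = *-cancelˡ-≤-pos (ℤ.+ 8 / 1) (begin
        ℤ.+ 8 / 1 * count
          ≡⟨ eightfold count ⟩
        (count + count) + ((count + count) + ((count + count) + (count + count)))
          ≤⟨ +-mono-≤ two-counts≤ (+-mono-≤ two-counts≤ (+-mono-≤ two-counts≤ two-counts≤)) ⟩
        Σ₄ n least-cycle + (Σ₄ n least-cycle + (Σ₄ n least-cycle + Σ₄ n least-cycle))
          ≤⟨ four-least-cycles≤ ⟩
        cycles W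
          ≤⟨ cycles≤1/32 wt total ⟩
        ℤ.+ 1 / 32 ∎)
        where
        open ≤-Reasoning
        eightfold : ∀ c → ℤ.+ 8 / 1 * c ≡ (c + c) + ((c + c) + ((c + c) + (c + c)))
        eightfold = solve-∀ ℚ-ring

  -- Powers, and symmetric weights from probability masses

  ^ℚ-nonNeg : ∀ {q} → 0ℚ ≤ q → ∀ k → 0ℚ ≤ q ^ℚ k
  ^ℚ-nonNeg 0≤q zero    = nonNegative⁻¹ 1ℚ
  ^ℚ-nonNeg 0≤q (suc k) = *-nonNeg 0≤q (^ℚ-nonNeg 0≤q k)

  ^ℚ-mono : ∀ {q r} → 0ℚ ≤ q → q ≤ r → ∀ k → q ^ℚ k ≤ r ^ℚ k
  ^ℚ-mono 0≤q q≤r zero    = ≤-refl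
  ^ℚ-mono 0≤q q≤r (suc k) =
    *-mono (≤-trans 0≤q q≤r) (^ℚ-nonNeg 0≤q k) q≤r (^ℚ-mono 0≤q q≤r k)

  ^ℚ-4* : ∀ q k → q ^ℚ (4 ℕ.* k) ≡ (q * (q * (q * q))) ^ℚ k
  ^ℚ-4* q zero    = refl
  ^ℚ-4* q (suc k) = begin
    q ^ℚ (4 ℕ.* suc k)                        ≡⟨ cong (q ^ℚ_) (ℕ.*-suc 4 k) ⟩
    q * (q * (q * (q * (q ^ℚ (4 ℕ.* k)))))    ≡⟨ regroup q (q ^ℚ (4 ℕ.* k)) ⟩
    q * (q * (q * q)) * (q ^ℚ (4 ℕ.* k))      ≡⟨ cong (q * (q * (q * q)) *_) (^ℚ-4* q k) ⟩
    q * (q * (q * q)) * ((q * (q * (q * q))) ^ℚ k) ∎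
    where
    open ≡-Reasoning
    regroup : ∀ q p → q * (q * (q * (q * p))) ≡ q * (q * (q * q)) * p
    regroup = solve-∀ ℚ-ring

  quarter^4* : ∀ k → quarter ^ℚ (4 ℕ.* k) ≡ (ℤ.+ 1 / 256) ^ℚ k
  quarter^4* = ^ℚ-4* quarter

  module _ {n : ℕ} {μ : Mass n} (μ≥0 : ∀ i j → i <F j → 0ℚ ≤ μ i j) where

    private
      -- The values of `μ` on and below the diagonal are arbitrary, possibly negative, and must be
      -- masked before symmetrising.
      increasing : Mass n
      increasing a b = lt a b * μ a b

      increasing≥0 : ∀ a b → 0ℚ ≤ increasing a b
      increasing≥0 a b with a <?F b
      ... | yes a<b = *-nonNeg (nonNegative⁻¹ 1ℚ) (μ≥0 a b a<b)
      ... | no  _   = ≤-reflexive (sym (*-zeroˡ (μ a b)))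

    symmetrised : Mass n
    symmetrised a b = increasing a b + increasing b a

    symmetrised-isWeight : IsWeight symmetrised
    symmetrised-isWeight = record
      { symmetric = λ a b → +-comm (increasing a b) (increasing b a)
      ; loopless  = λ a → cong₂ _+_ (diagonal a) (diagonal a)
      ; 0≤weight  = λ a b → +-nonNeg (increasing≥0 a b) (increasing≥0 b a)
      }
      where
      diagonal : ∀ a → increasing a a ≡ 0ℚ
      diagonal a = trans (cong (_* μ a a) (lt-no (<F-irrefl {x = a} refl))) (*-zeroˡ (μ a a))

    total-symmetrised : Σ₂ n symmetrised ≡ ΣPairs n μ + ΣPairs n μ
    total-symmetrised = trans (Σ₂-+ increasing (λ a b → increasing b a))
      (cong₂ _+_ (sym (ΣPairs≡Σ₂ μ)) (trans (ΣF-swap (λ a b → increasing b a)) (sym (ΣPairs≡Σ₂ μ))))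

    w≡symmetrised : ∀ a b → a ≢ b → w μ a b ≡ symmetrised a b
    w≡symmetrised a b a≢b with a <?F b | <F-cmp a b
    ... | yes a<b | _ = sym (trans
      (cong₂ _+_ (*-identityˡ (μ a b)) (trans (cong (_* μ b a) (lt-no (<F-asym a<b))) (*-zeroˡ (μ b a))))
      (+-identityʳ (μ a b)))
    ... | no a≮b | tri< a<b _ _ = ⊥-elim (a≮b a<b)
    ... | no a≮b | tri≈ _ a≡b _ = ⊥-elim (a≢b a≡b)
    ... | no a≮b | tri> _ _ b<a = sym (trans
      (cong₂ _+_ (*-zeroˡ (μ a b)) (trans (cong (_* μ b a) (lt-yes b<a)) (*-identityˡ (μ b a))))
      (+-identityˡ (μ b a)))

    open CycleCount symmetrised-isWeight

    μC4≡cycle : ∀ {a b c d} → a ≢ b → b ≢ c → c ≢ d → d ≢ a → μC4 μ a b c d ≡ cycle a b c d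
    μC4≡cycle {a} {b} {c} {d} a≢b b≢c c≢d d≢a = cong₂ _*_ (w≡symmetrised a b a≢b)
      (cong₂ _*_ (w≡symmetrised b c b≢c) (cong₂ _*_ (w≡symmetrised c d c≢d) (w≡symmetrised d a d≢a)))

    cycle-powers : ℕ → Fin n → Fin n → Fin n → Fin n → ℚ
    cycle-powers k a b c d = (cycle a b c d ^ℚ k) + ((cycle a b d c ^ℚ k) + (cycle a c b d ^ℚ k))

    βC4≡ : ∀ k → βC4 μ k ≡ Σ₄ n (λ a b c d → sorted a b c d * cycle-powers k a b c d)
    βC4≡ k = trans
      (ΣQuad≡Σ₄ (λ a b c d → (μC4 μ a b c d ^ℚ k) + ((μC4 μ a b d c ^ℚ k) + (μC4 μ a c b d ^ℚ k))))
      (Σ₄-cong pointwise)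
      where
      <⇒≢F : ∀ {i j : Fin n} → i <F j → i ≢ j
      <⇒≢F i<j i≡j = <F-irrefl i≡j i<j
      >⇒≢F : ∀ {i j : Fin n} → i <F j → j ≢ i
      >⇒≢F i<j j≡i = <F-irrefl (sym j≡i) i<j
      pointwise : ∀ a b c d →
        sorted a b c d * ((μC4 μ a b c d ^ℚ k) + ((μC4 μ a b d c ^ℚ k) + (μC4 μ a c b d ^ℚ k)))
          ≡ sorted a b c d * cycle-powers k a b c d
      pointwise a b c d with sorted-cases a b c d
      ... | inj₁ s≡0 = trans (vanish _) (sym (vanish (cycle-powers k a b c d)))
        where
        vanish : ∀ q → sorted a b c d * q ≡ 0ℚ
        vanish q = trans (cong (_* q) s≡0) (*-zeroˡ q)
      ... | inj₂ (_ , a<b , c<d , b<c) = cong (sorted a b c d *_) (cong₂ _+_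
        (cong (_^ℚ k) (μC4≡cycle (<⇒≢F a<b) (<⇒≢F b<c) (<⇒≢F c<d) (>⇒≢F a<d)))
        (cong₂ _+_
          (cong (_^ℚ k) (μC4≡cycle (<⇒≢F a<b) (<⇒≢F b<d) (>⇒≢F c<d) (>⇒≢F a<c)))
          (cong (_^ℚ k) (μC4≡cycle (<⇒≢F a<c) (>⇒≢F b<c) (<⇒≢F b<d) (>⇒≢F a<d)))))
        where
        a<c = <F-trans a<b b<c
        a<d = <F-trans a<c c<d
        b<d = <F-trans b<c c<d

    private
      sorted-nonNeg : ∀ (a b c d : Fin n) → 0ℚ ≤ sorted a b c d
      sorted-nonNeg a b c d = *-nonNeg (lt-nonNeg a b) (*-nonNeg (lt-nonNeg c d) (lt-nonNeg b c))

    cycle-powers≤βC4 : ∀ k a b c d → sorted a b c d * cycle-powers k a b c d ≤ βC4 μ k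
    cycle-powers≤βC4 k a b c d = ≤-trans
      (term≤Σ₄ {f = λ a b c d → sorted a b c d * cycle-powers k a b c d}
        (λ a b c d → *-nonNeg (sorted-nonNeg a b c d) (powers≥0 a b c d)) a b c d)
      (≤-reflexive (sym (βC4≡ k)))
      where
      powers≥0 : ∀ a b c d → 0ℚ ≤ cycle-powers k a b c d
      powers≥0 a b c d = +-nonNeg (^ℚ-nonNeg (cycle-nonNeg a b c d) k)
        (+-nonNeg (^ℚ-nonNeg (cycle-nonNeg a b d c) k) (^ℚ-nonNeg (cycle-nonNeg a c b d) k))

    βC4≤ : ΣPairs n μ ≡ 1ℚ → ∀ k → βC4 μ (suc k) ≤ (ℤ.+ 1 / 256) ^ℚ suc k
    βC4≤ total k = begin
      βC4 μ (suc k)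
        ≡⟨ βC4≡ (suc k) ⟩
      Σ₄ n (λ a b c d → sorted a b c d * cycle-powers (suc k) a b c d)
        ≤⟨ Σ₄-mono pointwise ⟩
      Σ₄ n (λ a b c d → r ^ℚ k * sorted-cycles a b c d)
        ≡⟨ trans (Σ₂-cong λ a b → Σ₂-*ˡ (r ^ℚ k) (sorted-cycles a b))
                 (Σ₂-*ˡ (r ^ℚ k) (λ a b → Σ₂ n (sorted-cycles a b))) ⟩
      r ^ℚ k * count
        ≤⟨ *-monoˡ (^ℚ-nonNeg 0≤r k) count≤r ⟩
      r ^ℚ k * r
        ≡⟨ *-comm (r ^ℚ k) r ⟩
      r ^ℚ suc k ∎
      where
      open ≤-Reasoning
      r : ℚ
      r = ℤ.+ 1 / 256

      0≤r : 0ℚ ≤ r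
      0≤r = nonNegative⁻¹ r

      count≤r : count ≤ r
      count≤r = count≤1/256 (trans total-symmetrised (cong₂ _+_ total total))

      sum≥0 : ∀ a b c d → 0ℚ ≤ cycle a b c d + (cycle a b d c + cycle a c b d)
      sum≥0 a b c d = +-nonNeg (cycle-nonNeg a b c d) (+-nonNeg (cycle-nonNeg a b d c) (cycle-nonNeg a c b d))

      power≤ : ∀ {q} → 0ℚ ≤ q → q ≤ r → q ^ℚ suc k ≤ r ^ℚ k * q
      power≤ {q} 0≤q q≤r = subst (q * (q ^ℚ k) ≤_) (*-comm q (r ^ℚ k)) (*-monoˡ 0≤q (^ℚ-mono 0≤q q≤r k))

      distribute : ∀ p x y z → p * x + (p * y + p * z) ≡ p * (x + (y + z))
      distribute = solve-∀ ℚ-ring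

      interchange : ∀ p s x → s * (p * x) ≡ p * (s * x)
      interchange = solve-∀ ℚ-ring

      pointwise : ∀ a b c d →
        sorted a b c d * cycle-powers (suc k) a b c d ≤ r ^ℚ k * sorted-cycles a b c d
      pointwise a b c d with sorted-cases a b c d
      ... | inj₁ s≡0 = ≤-reflexive (trans (vanish (cycle-powers (suc k) a b c d)) (sym (trans
        (cong (r ^ℚ k *_) (vanish (cycle a b c d + (cycle a b d c + cycle a c b d)))) (*-zeroʳ (r ^ℚ k)))))
        where
        vanish : ∀ q → sorted a b c d * q ≡ 0ℚ
        vanish q = trans (cong (_* q) s≡0) (*-zeroˡ q)
      ... | inj₂ (s≡1 , _) = begin
        sorted a b c d * cycle-powers (suc k) a b c d
          ≤⟨ *-monoˡ (sorted-nonNeg a b c d) (+-mono-≤ (power≤ 0≤g₁ g₁≤r)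
               (+-mono-≤ (power≤ 0≤g₂ g₂≤r) (power≤ 0≤g₃ g₃≤r))) ⟩
        sorted a b c d * (r ^ℚ k * g₁ + (r ^ℚ k * g₂ + r ^ℚ k * g₃))
          ≡⟨ cong (sorted a b c d *_) (distribute (r ^ℚ k) g₁ g₂ g₃) ⟩
        sorted a b c d * (r ^ℚ k * (g₁ + (g₂ + g₃)))
          ≡⟨ interchange (r ^ℚ k) (sorted a b c d) (g₁ + (g₂ + g₃)) ⟩
        r ^ℚ k * sorted-cycles a b c d ∎
        where
        g₁ g₂ g₃ : ℚ
        g₁ = cycle a b c d
        g₂ = cycle a b d c
        g₃ = cycle a c b d
        0≤g₁ : 0ℚ ≤ g₁
        0≤g₁ = cycle-nonNeg a b c d
        0≤g₂ : 0ℚ ≤ g₂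
        0≤g₂ = cycle-nonNeg a b d c
        0≤g₃ : 0ℚ ≤ g₃
        0≤g₃ = cycle-nonNeg a c b d
        sum≤r : g₁ + (g₂ + g₃) ≤ r
        sum≤r = ≤-trans
          (≤-reflexive (sym (trans (cong (_* (g₁ + (g₂ + g₃))) s≡1) (*-identityˡ (g₁ + (g₂ + g₃))))))
          (≤-trans (term≤Σ₄ {f = sorted-cycles}
            (λ a b c d → *-nonNeg (sorted-nonNeg a b c d) (sum≥0 a b c d)) a b c d) count≤r)
        g₁≤r : g₁ ≤ r
        g₁≤r = ≤-trans (≤-by-slack (g₂ + g₃) (+-nonNeg 0≤g₂ 0≤g₃) refl) sum≤r
        rest≤r : g₂ + g₃ ≤ r
        rest≤r = ≤-trans (≤-by-slack g₁ 0≤g₁ (+-comm (g₂ + g₃) g₁)) sum≤r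
        g₂≤r : g₂ ≤ r
        g₂≤r = ≤-trans (≤-by-slack g₃ 0≤g₃ refl) rest≤r
        g₃≤r : g₃ ≤ r
        g₃≤r = ≤-trans (≤-by-slack g₂ 0≤g₂ (+-comm g₃ g₂)) rest≤r

  -- The extremal mass

  uniform-C4 : Mass 4
  uniform-C4 zero             (suc zero)             = quarter
  uniform-C4 zero             (suc (suc (suc zero))) = quarter
  uniform-C4 (suc zero)       (suc (suc zero))       = quarter
  uniform-C4 (suc (suc zero)) (suc (suc (suc zero))) = quarter
  uniform-C4 _                _                      = 0ℚ

  uniform-C4≥0 : ∀ i j → 0ℚ ≤ uniform-C4 i j
  uniform-C4≥0 = toWitness {a? = all? λ i → all? λ j → 0ℚ ≤? uniform-C4 i j} _

  uniform-C4-isProbMass : IsProbMass uniform-C4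
  uniform-C4-isProbMass = (λ i j _ → uniform-C4≥0 i j) , refl

  βC4-uniform-C4 : ∀ k → (ℤ.+ 1 / 256) ^ℚ k ≤ βC4 uniform-C4 k
  βC4-uniform-C4 k = ≤-trans
    -- The other two 4-cycles on the four vertices use the diagonals, of weight 0. Their powers
    -- enter as slack because 0 to the power 0 is 1.
    (≤-by-slack (0ℚ ^ℚ k + 0ℚ ^ℚ k) (+-nonNeg (^ℚ-nonNeg ≤-refl k) (^ℚ-nonNeg ≤-refl k))
      (sym (*-identityˡ ((ℤ.+ 1 / 256) ^ℚ k + (0ℚ ^ℚ k + 0ℚ ^ℚ k)))))
    (cycle-powers≤βC4 {μ = uniform-C4} (λ i j _ → uniform-C4≥0 i j) k
      zero (suc zero) (suc (suc zero)) (suc (suc (suc zero))))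

open import Data.Nat using (ℕ; _≥_; _*_)
open import Data.Rational using (ℚ; 0ℚ; _≤_; _<_; _-_)
open import Data.Product using (_×_; Σ)

open FourCycles using (βC4≤; uniform-C4; uniform-C4-isProbMass; βC4-uniform-C4; quarter^4*)
open import Data.Nat.Base using (suc; s≤s)
open import Data.Product using (_,_)
open import Data.Rational.Properties using (≤-trans; ≤-reflexive; <-≤-trans; +-monoʳ-<; +-identityʳ; neg-antimono-<)
open import Relation.Binary.PropositionalEquality using (sym; subst)

theorem4p10 : (k : ℕ) → k ≥ 1 →
    -- upper bound: β_B(μ; C4, k) ≤ 4^(-4k) for every finite X and probability mass μ
    ((n : ℕ) (μ : Mass n) → IsProbMass μ → βC4 μ k ≤ quarter ^ℚ (4 * k))
    -- the bound is the supremum: approached arbitrarily closely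
    × ((ε : ℚ) → 0ℚ < ε →
        Σ ℕ (λ n → Σ (Mass n) (λ μ →
          IsProbMass μ × (quarter ^ℚ (4 * k)) - ε < βC4 μ k)))
theorem4p10 (suc k) (s≤s _) = upper , lower
  where
  bound : ℚ
  bound = quarter ^ℚ (4 * suc k)

  upper : (n : ℕ) (μ : Mass n) → IsProbMass μ → βC4 μ (suc k) ≤ bound
  upper n μ (μ≥0 , total) =
    ≤-trans (βC4≤ μ≥0 total k) (≤-reflexive (sym (quarter^4* (suc k))))

  lower : (ε : ℚ) → 0ℚ < ε → Σ ℕ λ n → Σ (Mass n) λ μ → IsProbMass μ × bound - ε < βC4 μ (suc k)
  -- The supremum is attained, so one mass serves for every ε.
  lower ε 0<ε = 4 , uniform-C4 , uniform-C4-isProbMass , <-≤-trans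
    (subst (bound - ε <_) (+-identityʳ bound) (+-monoʳ-< bound (neg-antimono-< 0<ε)))
    (≤-trans (≤-reflexive (quarter^4* (suc k))) (βC4-uniform-C4 (suc k)))
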